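{- Let $G$ be an $(n,d,\lambda)$-graph and $k$ a natural number. Then $$\alpha_k(G)\le n\,\frac{\tilde{W}_k+\sum_{j=1}^k\lambda^j}{\sum_{j=1}^k d^j+\sum_{j=1}^k\lambda^j}.$$
   Context: Graphs are undirected, simple and loopless. An $(n,d,\lambda)$-graph is a $d$-regular graph on $n$ vertices whose adjacency matrix $A$ has eigenvalues $d=\lambda_1\ge\lambda_2\ge\cdots\ge\lambda_n\ge -d$ (listed with multiplicity), where $\lambda=\max\{|\lambda_2|,|\lambda_n|\}$. The $k$-independence number $\alpha_k(G)$ is the maximum number of vertices of $G$ that are mutually at distance greater than $k$. $\tilde{W}_k=\max_i\sum_{j=1}^k (A^j)_{ii}$ is the maximum over all vertices $i$ of $G$ of the number of closed walks of length at most $k$ starting at $i$ (lengths $j=1,\dots,k$ being counted). -}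

module Defs where

open import Level using (Level; 0ℓ) renaming (suc to lsuc; _⊔_ to _⊔ˡ_)
open import Algebra.Apartness.Bundles using (HeytingField)
open import Algebra.Bundles using (CommutativeRing; Semiring)
open import Algebra.Core using (Op₂)
import Algebra.Definitions.RawSemiring as RawSemiringDefs
open import Data.Bool.Base using (if_then_else_)
open import Data.Fin.Base as Fin using (Fin; zero; suc; toℕ; fromℕ; punchIn)
open import Data.Fin.Properties using (_≟_)
open import Data.Fin.Subset using (Subset; _∈_; ∣_∣)
open import Data.Nat.Base as ℕ using (ℕ; zero; suc)
open import Data.Product.Base using (∃-syntax; _×_; proj₁)
open import Data.Sum.Base using (_⊎_)
import Data.Vec.Base as Vec
open import Data.Vec.Functional using (Vector; foldr)
open import Function.Bundles using (_⇔_)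
open import Relation.Binary.Core using (Rel)
open import Relation.Binary.Definitions using (Decidable; Irreflexive; Symmetric)
open import Relation.Binary.Lattice.Definitions using (Supremum)
open import Relation.Binary.PropositionalEquality.Core using (_≡_; _≢_)
open import Relation.Binary.Structures using (IsStrictPartialOrder)
open import Relation.Nullary.Decidable.Core using (does)
open import Relation.Nullary.Negation.Core using (¬_)

Matrix : ∀ {a} → Set a → ℕ → Set a
Matrix A n = Fin n → Fin n → A

------------------------------------------------------------------------
-- The real numbers

-- The library has no type of real numbers, so ℝ is given axiomatically,
-- as a Cauchy-complete Archimedean ordered field.  The axioms are stated
-- so that they hold constructively (e.g. for Bishop's regular sequences
-- of rationals); classically they determine ℝ up to isomorphism.

record RealNumbers c ℓ₁ ℓ₂ : Set (lsuc (c ⊔ˡ ℓ₁ ⊔ˡ ℓ₂)) where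
  infix  4 _<_ _≤_
  infixl 6 _⊔_
  infixl 7 _/_⟨_⟩

  field
    heytingField : HeytingField c ℓ₁ ℓ₂

  open HeytingField heytingField public hiding (zero)

  field
    _<_                  : Rel Carrier ℓ₂
    isStrictPartialOrder : IsStrictPartialOrder _≈_ _<_
    #⇔<⊎>                : ∀ {x y} → x # y ⇔ (x < y ⊎ y < x)
    +-monoˡ-<            : ∀ z {x y} → x < y → (x + z) < (y + z)
    *-pos                : ∀ {x y} → 0# < x → 0# < y → 0# < (x * y)

  _≤_ : Rel Carrier ℓ₂
  x ≤ y = ¬ (y < x)

  -- Binary maxima are part of the structure: without deciding the order
  -- they cannot be obtained by a case distinction.
  field
    _⊔_      : Op₂ Carrier
    supremum : Supremum _≤_ _⊔_

  abs : Carrier → Carrier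
  abs x = x ⊔ (- x)

  commutativeRing : CommutativeRing c ℓ₁
  commutativeRing = record { isCommutativeRing = isCommutativeRing }

  open RawSemiringDefs
    (Semiring.rawSemiring (CommutativeRing.semiring commutativeRing)) public
    using (sum; product; _^_) renaming (_×_ to _·_)

  ι : ℕ → Carrier
  ι n = n · 1#

  IsCauchy : (ℕ → Carrier) → Set (c ⊔ˡ ℓ₂)
  IsCauchy s = ∀ ε → 0# < ε →
    ∃[ N ] (∀ m n → N ℕ.≤ m → N ℕ.≤ n → abs (s m - s n) < ε)

  _ConvergesTo_ : (ℕ → Carrier) → Carrier → Set (c ⊔ˡ ℓ₂)
  s ConvergesTo x = ∀ ε → 0# < ε →
    ∃[ N ] (∀ n → N ℕ.≤ n → abs (s n - x) < ε)

  field
    archimedean : ∀ x → ∃[ n ] (x < ι n)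
    complete    : ∀ s → IsCauchy s → ∃[ x ] (s ConvergesTo x)

  -- The library's Heyting fields invert differences of apart elements;
  -- here the difference is y - 0#.
  _/_⟨_⟩ : Carrier → (y : Carrier) → y # 0# → Carrier
  x / y ⟨ y#0 ⟩ = x * proj₁ (#⇒invertible y#0)

  -- x + x² + ⋯ + xᵏ
  powerSum : Carrier → ℕ → Carrier
  powerSum x k = sum {k} (λ j → x ^ suc (toℕ j))

------------------------------------------------------------------------
-- Graphs

record Graph (n : ℕ) : Set₁ where
  infix 4 _~_ _~?_
  field
    _~_      : Rel (Fin n) 0ℓ
    _~?_     : Decidable _~_
    ~-sym    : Symmetric _~_
    ~-irrefl : Irreflexive _≡_ _~_

module _ {n : ℕ} (G : Graph n) where
  open Graph G

  degree : Fin n → ℕ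
  degree i = ∣ Vec.tabulate (λ j → does (i ~? j)) ∣

  IsRegular : ℕ → Set
  IsRegular d = ∀ i → degree i ≡ d

  adjacency : Matrix ℕ n
  adjacency i j = if does (i ~? j) then 1 else 0

  data Walk : ℕ → Fin n → Fin n → Set where
    []  : ∀ {i} → Walk 0 i i
    _∷_ : ∀ {ℓ i j l} → i ~ j → Walk ℓ j l → Walk (suc ℓ) i l

  IsDistance : Fin n → Fin n → ℕ → Set
  IsDistance i j ℓ = Walk ℓ i j × (∀ m → Walk m i j → ℓ ℕ.≤ m)

  -- Vertices in different components have no IsDistance value, i.e.
  -- distance ∞, and are therefore at distance greater than every k.
  DistanceGreaterThan : ℕ → Fin n → Fin n → Set
  DistanceGreaterThan k i j = ∀ ℓ → IsDistance i j ℓ → k ℕ.< ℓ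

  IsKIndependent : ℕ → Subset n → Set
  IsKIndependent k S =
    ∀ {i j} → i ∈ S → j ∈ S → i ≢ j → DistanceGreaterThan k i j

  -- "α is the k-independence number αₖ(G)"
  IsKIndependenceNumber : ℕ → ℕ → Set
  IsKIndependenceNumber k α =
    (∃[ S ] (IsKIndependent k S × ∣ S ∣ ≡ α)) ×
    (∀ S → IsKIndependent k S → ∣ S ∣ ℕ.≤ α)

module _ where
  open RawSemiringDefs ℕ.+-*-rawSemiring using (sum)

  matrixPower : ∀ {n} → Matrix ℕ n → ℕ → Matrix ℕ n
  matrixPower M zero    i j = if does (i ≟ j) then 1 else 0
  matrixPower M (suc k) i j = sum (λ l → M i l ℕ.* matrixPower M k l j)

  W̃ : ∀ {n} → Graph n → ℕ → ℕ
  W̃ G k = foldr ℕ._⊔_ 0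
    (λ i → sum {k} (λ j → matrixPower (adjacency G) (suc (toℕ j)) i i))

------------------------------------------------------------------------
-- Spectra

module _ {c ℓ₁ ℓ₂ : Level} (ℝ : RealNumbers c ℓ₁ ℓ₂) where
  open RealNumbers ℝ

  -- Laplace expansion along the first row
  det : ∀ {n} → Matrix Carrier n → Carrier
  det {zero}  M = 1#
  det {suc n} M = sum (λ j →
    ((- 1#) ^ toℕ j) * M zero j * det (λ i l → M (suc i) (punchIn j l)))

  -- det (x I - M)
  charPoly : ∀ {n} → Matrix Carrier n → Carrier → Carrier
  charPoly M x = det (λ i j → (if does (i ≟ j) then x else 0#) - M i j)

  -- "μ₀ ≥ μ₁ ≥ ⋯ are the eigenvalues of M, listed with multiplicity", the
  -- multiplicity being that of a root of the characteristic polynomial.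
  -- As ℝ is infinite, the factorisation of the polynomial det (x I - M)
  -- may be expressed as an identity of functions of x.
  record IsSpectrum {n} (M : Matrix Carrier n) (μ : Vector Carrier n)
                    : Set (c ⊔ˡ ℓ₁ ⊔ˡ ℓ₂) where
    field
      charPoly-splits : ∀ x → charPoly M x ≈ product (λ i → x - μ i)
      decreasing      : ∀ {i j} → i Fin.≤ j → μ j ≤ μ i

  -- G is an (n, d, Λ)-graph, where n = 2 + m since Λ refers to λ₂.
  -- The indices of λ₁, …, λₙ are shifted by one.
  record IsNDΛGraph {m} (G : Graph (2 ℕ.+ m)) (d : ℕ) (Λ : Carrier)
                    : Set (c ⊔ˡ ℓ₁ ⊔ˡ ℓ₂) where
    field
      regular    : IsRegular G d
      eigenvalue : Vector Carrier (2 ℕ.+ m)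
      isSpectrum : IsSpectrum (λ i j → ι (adjacency G i j)) eigenvalue

    λ₁ : Carrier
    λ₁ = eigenvalue zero

    λ₂ : Carrier
    λ₂ = eigenvalue (suc zero)

    λₙ : Carrier
    λₙ = eigenvalue (fromℕ (suc m))

    field
      λ₁≈d  : λ₁ ≈ ι d
      -d≤λₙ : (- ι d) ≤ λₙ
      Λ≈max : Λ ≈ abs λ₂ ⊔ abs λₙ

{-# OPTIONS --safe #-}

-- Let A be the adjacency matrix, v the projection of the indicator of a
-- k-independent set S to the space orthogonal to the constants, and p(x) =
-- x + ⋯ + xᵏ.  The off-diagonal entries of p(A) between vertices of S
-- vanish, so ⟨1_S, p(A) 1_S⟩ ≤ |S| W̃ₖ, and the bound follows from
-- ⟨v, p(A) v⟩ ≥ - p(Λ) |v|².  It suffices to know |Av| ≤ Λ |v| for every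
-- v ⊥ 1, for which no eigenvectors are needed: the characteristic
-- polynomial of M² is obtained from that of M by Graeffe's factorisation
-- 1 - s²M² = (1 - sM)(1 + sM), so tr A^N = Σ μᵢ^N for N a power of 2.
-- Removing the constants from A^(N/2) gives
-- |A^(N/2) v|² ≤ (tr A^N - d^N) |v|² ≤ (n - 1) Λ^N |v|², while
-- (|Av|/|v|)^N ≤ |A^(N/2) v|²/|v|² by Cauchy–Schwarz; now let N grow.

module Submission where

open import Defs
open import Algebra.Bundles using (CommutativeRing)
import Algebra.Apartness.Properties.HeytingCommutativeRing as HeytingProperties
import Algebra.Definitions.RawSemiring as RawSemiringDefs
import Algebra.Properties.CommutativeMonoid.Sum as MonoidSum
import Algebra.Properties.Ring as RingProperties
import Algebra.Properties.Semiring.Mult as MultProperties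
import Algebra.Properties.Semiring.Mult.TCOptimised as Mult′Properties
import Algebra.Properties.Semiring.Sum as SumProperties
import Algebra.Solver.Ring as RingSolver
open import Algebra.Solver.Ring.AlmostCommutativeRing
  using (_-Raw-AlmostCommutative⟶_; fromCommutativeRing)
open import Data.Bool.Base using (Bool; true; false; if_then_else_)
open import Data.Fin.Base using (Fin; zero; suc; toℕ; punchIn)
open import Data.Fin.Properties as Finₚ using (_≟_)
open import Data.Fin.Subset using (Subset; _∈_; ∣_∣)
open import Data.Integer.Base as ℤ using (ℤ; +_; -[1+_])
import Data.Integer.Properties as ℤₚ
open import Data.Maybe.Base using (just; nothing)
open import Data.Nat.Base as ℕ using (ℕ; zero; suc)
open import Data.Nat.Induction using (<-rec)
import Data.Nat.Properties as ℕₚ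
open import Data.Product.Base using (_×_; _,_; proj₁; proj₂; ∃-syntax; Σ-syntax)
open import Data.Sum.Base using (_⊎_; inj₁; inj₂)
open import Data.Unit.Base using (⊤; tt)
open import Data.Vec.Base as Vec using (Vec; []; _∷_)
open import Data.Vec.Functional using (Vector; tail; insertAt; foldr)
import Data.Vec.Properties as Vecₚ
open import Function.Base using (_∘_)
open import Function.Bundles using (Equivalence)
open import Level using (Lift; lift) renaming (_⊔_ to _⊔ˡ_)
open import Relation.Binary.Definitions using (WeaklyDecidable)
import Relation.Binary.PropositionalEquality as ≡
open import Relation.Binary.PropositionalEquality using (_≡_; _≢_)
import Relation.Binary.Reasoning.Base.Triple as TripleReasoning
import Relation.Binary.Reasoning.Setoid as SetoidReasoning
open import Relation.Binary.Structures using (IsStrictPartialOrder; IsPreorder)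
open import Relation.Nullary.Decidable.Core using (does; yes; no)
open import Relation.Nullary.Negation.Core using (¬_; contradiction)

-- The spectrum is given only through a factorisation of `charPoly`, with no eigenbasis attached, so
-- everything about A must be read off from determinants. The one coefficient ever extracted is that
-- of t in det (1 - tM), which is the trace. Multiplicativity of the determinant carries a
-- factorisation from M to M², and that is why only powers of 2 occur as exponents. Graeffe's
-- factorisation speaks of t = s², so the factorisation for M² is at first known only at squares. To
-- extend it to all t, in particular to t near 0 where the trace is found, determinants are tracked
-- as polynomial functions of t. The trace estimate loses the factor n - 1. It stays fixed while N
-- grows, so a Bernoulli inequality and the Archimedean property dispose of it without taking roots.
-- The order is undecidable, but `_≤_` is a negation, so inequalities may be proved by classical
-- case distinction. Divisions are postponed throughout by clearing denominators.

-- Integer coefficients for the ring solver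

module IntegerCoefficients {c ℓ} (R : CommutativeRing c ℓ) where
  open CommutativeRing R
  open Mult′Properties semiring using ()
    renaming (_×_ to _·′_; ×-homo-+ to ·′-homo-+; 1+× to 1+·′; ×1-homo-* to ·′1-homo-*)
  open RingProperties ring
  open SetoidReasoning setoid

  -- With the optimised multiple, `1 ·′ 1#` computes to `1#`, so `con (+ 1)` denotes `1#` itself.
  -- The multiple behind `ι` would give `1# + 0#`, which is why `ι 2` is later spelled out as a sum
  -- in solver expressions.
  ⟦_⟧ℤ : ℤ → Carrier
  ⟦ + n      ⟧ℤ = n ·′ 1#
  ⟦ -[1+ n ] ⟧ℤ = - (suc n ·′ 1#)

  -‿homo : ∀ i → ⟦ ℤ.- i ⟧ℤ ≈ - ⟦ i ⟧ℤ
  -‿homo (+ zero)  = sym -0#≈0#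
  -‿homo (+ suc n) = refl
  -‿homo -[1+ n ]  = sym (-‿involutive _)

  ⊖-homo : ∀ m n → ⟦ m ℤ.⊖ n ⟧ℤ ≈ m ·′ 1# - n ·′ 1#
  ⊖-homo m zero = sym (trans (+-congˡ -0#≈0#) (+-identityʳ _))
  ⊖-homo zero (suc n) = sym (+-identityˡ _)
  ⊖-homo (suc m) (suc n) = begin
    ⟦ suc m ℤ.⊖ suc n ⟧ℤ                  ≡⟨ ≡.cong ⟦_⟧ℤ (ℤₚ.[1+m]⊖[1+n]≡m⊖n m n) ⟩
    ⟦ m ℤ.⊖ n ⟧ℤ                          ≈⟨ ⊖-homo m n ⟩
    m ·′ 1# - n ·′ 1#                       ≈⟨ +-congʳ (+-identityˡ _) ⟨
    0# + m ·′ 1# - n ·′ 1#                  ≈⟨ +-congʳ (+-congʳ (-‿inverseʳ 1#)) ⟨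
    1# - 1# + m ·′ 1# - n ·′ 1#             ≈⟨ +-congʳ (+-assoc 1# (- 1#) (m ·′ 1#)) ⟩
    1# + (- 1# + m ·′ 1#) - n ·′ 1#         ≈⟨ +-congʳ (+-congˡ (+-comm _ _)) ⟩
    1# + (m ·′ 1# - 1#) - n ·′ 1#           ≈⟨ +-congʳ (+-assoc 1# (m ·′ 1#) (- 1#)) ⟨
    1# + m ·′ 1# - 1# - n ·′ 1#             ≈⟨ +-assoc _ _ _ ⟩
    1# + m ·′ 1# + (- 1# - n ·′ 1#)         ≈⟨ +-cong (sym (1+·′ m 1#)) (-‿+-comm _ _) ⟩
    suc m ·′ 1# - (1# + n ·′ 1#)            ≈⟨ +-congˡ (-‿cong (1+·′ n 1#)) ⟨
    suc m ·′ 1# - suc n ·′ 1#               ∎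

  +-homo : ∀ i j → ⟦ i ℤ.+ j ⟧ℤ ≈ ⟦ i ⟧ℤ + ⟦ j ⟧ℤ
  +-homo (+ m)    (+ n)    = ·′-homo-+ 1# m n
  +-homo (+ m)    -[1+ n ] = ⊖-homo m (suc n)
  +-homo -[1+ m ] (+ n)    = trans (⊖-homo n (suc m)) (+-comm _ _)
  +-homo -[1+ m ] -[1+ n ] = begin
    - (suc (suc (m ℕ.+ n)) ·′ 1#)         ≡⟨ ≡.cong (λ k → - (suc k ·′ 1#)) (ℕₚ.+-suc m n) ⟨
    - ((suc m ℕ.+ suc n) ·′ 1#)           ≈⟨ -‿cong (·′-homo-+ 1# (suc m) (suc n)) ⟩
    - (suc m ·′ 1# + suc n ·′ 1#)          ≈⟨ -‿+-comm _ _ ⟨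
    - (suc m ·′ 1#) - suc n ·′ 1#          ∎

  *-homo-pos : ∀ m j → ⟦ + m ℤ.* j ⟧ℤ ≈ ⟦ + m ⟧ℤ * ⟦ j ⟧ℤ
  *-homo-pos m (+ n) = begin
    ⟦ + m ℤ.* + n ⟧ℤ     ≡⟨ ≡.cong ⟦_⟧ℤ (ℤₚ.pos-* m n) ⟨
    (m ℕ.* n) ·′ 1#       ≈⟨ ·′1-homo-* m n ⟩
    m ·′ 1# * (n ·′ 1#)    ∎
  *-homo-pos m -[1+ n ] = begin
    ⟦ + m ℤ.* -[1+ n ] ⟧ℤ              ≡⟨ ≡.cong ⟦_⟧ℤ (ℤₚ.neg-distribʳ-* (+ m) (+ suc n)) ⟨
    ⟦ ℤ.- (+ m ℤ.* + suc n) ⟧ℤ         ≈⟨ -‿homo (+ m ℤ.* + suc n) ⟩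
    - ⟦ + m ℤ.* + suc n ⟧ℤ             ≈⟨ -‿cong (*-homo-pos m (+ suc n)) ⟩
    - (m ·′ 1# * (suc n ·′ 1#))          ≈⟨ -‿distribʳ-* _ _ ⟩
    m ·′ 1# * - (suc n ·′ 1#)            ∎

  *-homo : ∀ i j → ⟦ i ℤ.* j ⟧ℤ ≈ ⟦ i ⟧ℤ * ⟦ j ⟧ℤ
  *-homo (+ m)    j = *-homo-pos m j
  *-homo -[1+ m ] j = begin
    ⟦ -[1+ m ] ℤ.* j ⟧ℤ              ≡⟨ ≡.cong ⟦_⟧ℤ (ℤₚ.neg-distribˡ-* (+ suc m) j) ⟨
    ⟦ ℤ.- (+ suc m ℤ.* j) ⟧ℤ         ≈⟨ -‿homo (+ suc m ℤ.* j) ⟩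
    - ⟦ + suc m ℤ.* j ⟧ℤ             ≈⟨ -‿cong (*-homo-pos (suc m) j) ⟩
    - (suc m ·′ 1# * ⟦ j ⟧ℤ)          ≈⟨ -‿distribˡ-* _ _ ⟩
    - (suc m ·′ 1#) * ⟦ j ⟧ℤ          ∎

  morphism : ℤ.+-*-rawRing -Raw-AlmostCommutative⟶ fromCommutativeRing R
  morphism = record
    { ⟦_⟧    = ⟦_⟧ℤ
    ; +-homo = +-homo
    ; *-homo = *-homo
    ; -‿homo = -‿homo
    ; 0-homo = refl
    ; 1-homo = refl
    }

  _≟ℤ_ : WeaklyDecidable (λ i j → ⟦ i ⟧ℤ ≈ ⟦ j ⟧ℤ)
  i ≟ℤ j with i ℤₚ.≟ j
  ... | yes i≡j = just (reflexive (≡.cong ⟦_⟧ℤ i≡j))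
  ... | no  _   = nothing

  open RingSolver ℤ.+-*-rawRing (fromCommutativeRing R) morphism _≟ℤ_ public
    using (Polynomial; solve; _:=_; con; _:+_; _:*_; _:-_; :-_)

-- Determinants: uniqueness of alternating forms and multiplicativity

module Determinants {c ℓ₁ ℓ₂} (ℝ : RealNumbers c ℓ₁ ℓ₂) where
  open RealNumbers ℝ
  open CommutativeRing commutativeRing using (ring; semiring)
  open RingProperties ring
  private module Sum = SumProperties semiring
  open IntegerCoefficients commutativeRing
  open SetoidReasoning setoid

  infix 4 _≋_
  _≋_ : ∀ {n} → Vector Carrier n → Vector Carrier n → Set ℓ₁
  u ≋ v = ∀ i → u i ≈ v i

  δ : ∀ {n} → Matrix Carrier n
  δ i j = if does (i ≟ j) then 1# else 0#

  sign : ∀ {n} → Fin n → Carrier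
  sign j = (- 1#) ^ toℕ j

  -- Both are opaque so that unification can read off their arguments.
  opaque
    ∑ : ∀ {n} → Vector Carrier n → Carrier
    ∑ f = sum f

    Det : ∀ {n} → Matrix Carrier n → Carrier
    Det M = det ℝ M

  opaque
    unfolding ∑

    ∑≡sum : ∀ {n} (f : Vector Carrier n) → ∑ f ≡ sum f
    ∑≡sum f = ≡.refl

    ∑-empty : (f : Vector Carrier 0) → ∑ f ≈ 0#
    ∑-empty f = refl

    ∑-suc : ∀ {n} (f : Vector Carrier (suc n)) → ∑ f ≈ f zero + ∑ (f ∘ suc)
    ∑-suc f = refl

    ∑-cong : ∀ {n} {f g : Vector Carrier n} → f ≋ g → ∑ f ≈ ∑ g
    ∑-cong = Sum.sum-cong-≋

    ∑-+ : ∀ {n} (f g : Vector Carrier n) → ∑ (λ i → f i + g i) ≈ ∑ f + ∑ g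
    ∑-+ = Sum.∑-distrib-+

    ∑-* : ∀ {n} a (f : Vector Carrier n) → a * ∑ f ≈ ∑ (λ i → a * f i)
    ∑-* = Sum.*-distribˡ-sum

    ∑-comm : ∀ {m n} (f : Fin m → Fin n → Carrier) →
             ∑ (λ i → ∑ (λ j → f i j)) ≈ ∑ (λ j → ∑ (λ i → f i j))
    ∑-comm = Sum.∑-comm

    ∑-zero : ∀ {n} {f : Vector Carrier n} → (∀ i → f i ≈ 0#) → ∑ f ≈ 0#
    ∑-zero {zero}  f≈0 = refl
    ∑-zero {suc n} f≈0 = trans (+-cong (f≈0 zero) (∑-zero (f≈0 ∘ suc))) (+-identityˡ 0#)

    Det≡det : ∀ {n} (M : Matrix Carrier n) → Det M ≡ det ℝ M
    Det≡det M = ≡.refl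

    Det-empty : (M : Matrix Carrier 0) → Det M ≈ 1#
    Det-empty M = refl

    Det-suc : ∀ {n} (M : Matrix Carrier (suc n)) →
      Det M ≈ ∑ (λ j → sign j * M zero j * Det (λ i l → M (suc i) (punchIn j l)))
    Det-suc M = refl

  Det-cong : ∀ {n} {M N : Matrix Carrier n} → (∀ i j → M i j ≈ N i j) → Det M ≈ Det N
  Det-cong {zero}  {M} {N} M≈N = trans (Det-empty M) (sym (Det-empty N))
  Det-cong {suc n} {M} {N} M≈N = trans (Det-suc M) (trans
    (∑-cong λ j → *-cong (*-congˡ (M≈N zero j)) (Det-cong λ i l → M≈N (suc i) (punchIn j l)))
    (sym (Det-suc N)))

  record IsLinear {w} (f : Vector Carrier w → Carrier) : Set (c ⊔ˡ ℓ₁) where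
    field
      cong  : ∀ {u v} → u ≋ v → f u ≈ f v
      +-hom : ∀ u v → f (λ i → u i + v i) ≈ f u + f v
      *-hom : ∀ a u → f (λ i → a * u i) ≈ a * f u

  open IsLinear

  extend : ∀ {w} → Vector Carrier w → Vector Carrier (suc w)
  extend u = insertAt u zero 0#

  extend-δ : ∀ {w} (j : Fin w) → extend (δ j) ≋ δ (suc j)
  extend-δ {suc w} j zero    = refl
  extend-δ {suc w} j (suc i) = refl

  insert-≋ : ∀ {w} {u v : Vector Carrier w} j → u ≋ v → insertAt u j 0# ≋ insertAt v j 0#
  insert-≋ {suc w} zero    u≋v zero    = refl
  insert-≋ {suc w} zero    u≋v (suc i) = u≋v i
  insert-≋ {zero}  zero    u≋v zero    = refl
  insert-≋ {suc w} (suc j) u≋v zero    = u≋v zero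
  insert-≋ {suc w} (suc j) u≋v (suc i) = insert-≋ j (u≋v ∘ suc) i

  insert-+ : ∀ {w} (u v : Vector Carrier w) j →
             insertAt (λ i → u i + v i) j 0# ≋ λ i → insertAt u j 0# i + insertAt v j 0# i
  insert-+ {suc w} u v zero    zero    = sym (+-identityˡ 0#)
  insert-+ {suc w} u v zero    (suc i) = refl
  insert-+ {zero}  u v zero    zero    = sym (+-identityˡ 0#)
  insert-+ {suc w} u v (suc j) zero    = refl
  insert-+ {suc w} u v (suc j) (suc i) = insert-+ (tail u) (tail v) j i

  insert-* : ∀ {w} a (u : Vector Carrier w) j →
             insertAt (λ i → a * u i) j 0# ≋ λ i → a * insertAt u j 0# i
  insert-* {suc w} a u zero    zero    = sym (zeroʳ a)
  insert-* {suc w} a u zero    (suc i) = refl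
  insert-* {zero}  a u zero    zero    = sym (zeroʳ a)
  insert-* {suc w} a u (suc j) zero    = refl
  insert-* {suc w} a u (suc j) (suc i) = insert-* a (tail u) j i

  record IsLinearMap {w w′} (L : Vector Carrier w → Vector Carrier w′) : Set (c ⊔ˡ ℓ₁) where
    field
      Lcong  : ∀ {u v} → u ≋ v → L u ≋ L v
      L+-hom : ∀ u v → L (λ i → u i + v i) ≋ λ i → L u i + L v i
      L*-hom : ∀ a u → L (λ i → a * u i) ≋ λ i → a * L u i

  open IsLinearMap

  insertAt-linear : ∀ {w} (j : Fin (suc w)) → IsLinearMap (λ u → insertAt u j 0#)
  insertAt-linear j = record
    { Lcong = insert-≋ j ; L+-hom = λ u v → insert-+ u v j ; L*-hom = λ a u → insert-* a u j }

  linear-∘ : ∀ {w w′} {L : Vector Carrier w → Vector Carrier w′} {f} →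
             IsLinear f → IsLinearMap L → IsLinear (f ∘ L)
  linear-∘ f-lin L-lin = record
    { cong  = λ u≋v → cong f-lin (Lcong L-lin u≋v)
    ; +-hom = λ u v → trans (cong f-lin (L+-hom L-lin u v)) (+-hom f-lin _ _)
    ; *-hom = λ a u → trans (cong f-lin (L*-hom L-lin a u)) (*-hom f-lin a _)
    }

  linear-expand : ∀ {w} {f : Vector Carrier w → Carrier} → IsLinear f →
                  ∀ u → f u ≈ ∑ (λ j → u j * f (δ j))
  linear-expand {zero} {f} f-lin u = begin
    -- In dimension 0 any two vectors agree vacuously, so `u` may be replaced by its multiple by
    -- `0#`.
    f u                  ≈⟨ cong f-lin {u} {λ i → 0# * u i} (λ ()) ⟩
    f (λ i → 0# * u i)   ≈⟨ *-hom f-lin 0# u ⟩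
    0# * f u             ≈⟨ zeroˡ _ ⟩
    0#                   ≈⟨ ∑-empty _ ⟨
    ∑ (λ j → u j * f (δ j)) ∎
  linear-expand {suc w} {f} f-lin u = begin
    f u                                                        ≈⟨ cong f-lin split ⟩
    f (λ i → u zero * δ zero i + extend (tail u) i)            ≈⟨ +-hom f-lin _ _ ⟩
    f (λ i → u zero * δ zero i) + f (extend (tail u))          ≈⟨ +-cong (*-hom f-lin _ _)
        (linear-expand (linear-∘ f-lin (insertAt-linear zero)) (tail u)) ⟩
    u zero * f (δ zero) + ∑ (λ j → u (suc j) * f (extend (δ j)))
        ≈⟨ +-congˡ (∑-cong λ j → *-congˡ (cong f-lin (extend-δ j))) ⟩
    u zero * f (δ zero) + ∑ (λ j → u (suc j) * f (δ (suc j)))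
        ≈⟨ ∑-suc _ ⟨
    ∑ (λ j → u j * f (δ j))  ∎
    where
    split : u ≋ λ i → u zero * δ zero i + extend (tail u) i
    split zero    = sym (trans (+-identityʳ _) (*-identityʳ _))
    split (suc i) = sym (trans (+-congʳ (zeroʳ _)) (+-identityˡ _))

  -- An alternating multilinear function of n rows, its arguments being
  -- taken one at a time; alternation is only required of adjacent rows.
  VanishesOnRepeat : ∀ {w n} → (Vec (Vector Carrier w) (suc n) → Carrier) → Set (c ⊔ˡ ℓ₁)
  VanishesOnRepeat {n = zero}  D = Lift (c ⊔ˡ ℓ₁) ⊤
  VanishesOnRepeat {n = suc n} D = Lift (c ⊔ˡ ℓ₁) (∀ r rs → D (r ∷ r ∷ rs) ≈ 0#)

  IsAlternating : ∀ {w} n → (Vec (Vector Carrier w) n → Carrier) → Set (c ⊔ˡ ℓ₁)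
  IsAlternating zero    D = Lift (c ⊔ˡ ℓ₁) ⊤
  IsAlternating (suc n) D = (∀ rs → IsLinear (λ r → D (r ∷ rs)))
                          × (∀ r → IsAlternating n (λ rs → D (r ∷ rs)))
                          × VanishesOnRepeat D

  -- Three cases because `VanishesOnRepeat` computes only once it is known whether there is a second
  -- row.
  alternating-∘ : ∀ {w w′} n {D} {L : Vector Carrier w → Vector Carrier w′} → IsLinearMap L →
                  IsAlternating n D → IsAlternating n (D ∘ Vec.map L)
  alternating-∘ zero          L-lin _ = lift tt
  alternating-∘ (suc zero)    L-lin (lin , alt , _) =
    (λ rs → linear-∘ (lin _) L-lin) , (λ r → lift tt) , lift tt
  alternating-∘ (suc (suc n)) L-lin (lin , alt , lift rep) =
    (λ rs → linear-∘ (lin _) L-lin) , (λ r → alternating-∘ (suc n) L-lin (alt _)) ,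
    lift λ r rs → rep _ _

  linear-sum : ∀ {w m} (a : Vector Carrier m) {f : Fin m → Vector Carrier w → Carrier} →
    (∀ j → IsLinear (f j)) → IsLinear (λ r → ∑ (λ j → a j * f j r))
  linear-sum {m = m} a {f} f-lin = record
    { cong  = λ u≋v → ∑-cong λ j → *-congˡ (cong (f-lin j) u≋v)
    ; +-hom = λ u v → trans
        (∑-cong λ j → trans (*-congˡ (+-hom (f-lin j) u v)) (distribˡ _ _ _))
        (∑-+ _ _)
    ; *-hom = λ b u → trans
        (∑-cong λ j → trans (*-congˡ (*-hom (f-lin j) b u))
          (solve 3 (λ a b x → a :* (b :* x) := b :* (a :* x)) refl (a j) b (f j u)))
        (sym (∑-* b _))
    }

  alternating-sum : ∀ {w} n {m} (a : Vector Carrier m)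
    {E : Fin m → Vec (Vector Carrier w) n → Carrier} → (∀ j → IsAlternating n (E j)) →
    IsAlternating n (λ rs → ∑ (λ j → a j * E j rs))
  alternating-sum zero a alt = lift tt
  alternating-sum (suc zero) a alt =
    (λ rs → linear-sum a (λ j → proj₁ (alt j) rs)) , (λ r → lift tt) , lift tt
  alternating-sum (suc (suc n)) {m} a alt =
    (λ rs → linear-sum a (λ j → proj₁ (alt j) rs)) ,
    (λ r → alternating-sum (suc n) a (λ j → proj₁ (proj₂ (alt j)) r)) ,
    lift λ r rs → ∑-zero λ j → trans (*-congˡ (Lift.lower (proj₂ (proj₂ (alt j))) r rs)) (zeroʳ _)

  module Swap {w n} {D : Vec (Vector Carrier w) (suc (suc n)) → Carrier}
              (D-alt : IsAlternating (suc (suc n)) D) where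
    private
      repeat : ∀ r rs → D (r ∷ r ∷ rs) ≈ 0#
      repeat = Lift.lower (proj₂ (proj₂ D-alt))
      lin₁ : ∀ rs → IsLinear (λ r → D (r ∷ rs))
      lin₁ = proj₁ D-alt
      lin₂ : ∀ r rs → IsLinear (λ s → D (r ∷ s ∷ rs))
      lin₂ r = proj₁ (proj₁ (proj₂ D-alt) r)

    -- Polarisation: expanding the form at the repeated row `t = r + s` leaves only the two mixed
    -- terms.
    swap : ∀ r s rs → D (r ∷ s ∷ rs) ≈ - D (s ∷ r ∷ rs)
    swap r s rs = +-inverseˡ-unique _ _ (begin
      D (r ∷ s ∷ rs) + D (s ∷ r ∷ rs)
        ≈⟨ +-cong (+-identityˡ _) (+-identityʳ _) ⟨
      (0# + D (r ∷ s ∷ rs)) + (D (s ∷ r ∷ rs) + 0#)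
        ≈⟨ +-cong (+-congʳ (repeat r rs)) (+-congˡ (repeat s rs)) ⟨
      (D (r ∷ r ∷ rs) + D (r ∷ s ∷ rs)) + (D (s ∷ r ∷ rs) + D (s ∷ s ∷ rs))
        ≈⟨ +-cong (+-hom (lin₂ r rs) r s) (+-hom (lin₂ s rs) r s) ⟨
      D (r ∷ t ∷ rs) + D (s ∷ t ∷ rs)
        ≈⟨ +-hom (lin₁ (t ∷ rs)) r s ⟨
      D (t ∷ t ∷ rs)
        ≈⟨ repeat t rs ⟩
      0# ∎)
      where
      t : Vector Carrier w
      t i = r i + s i

  -- Repeats are only known to vanish for adjacent rows. So after the multiple of `u` is removed
  -- from `r`, the rows `u` and `r` are swapped, the induction hypothesis is used for the form with
  -- `r` held fixed in front, and the swap is undone. The coefficient `κ` may depend on the row,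
  -- which later allows a whole column to be cleared at once.
  alternating-shear : ∀ {w} n {D : Vec (Vector Carrier w) (suc n) → Carrier} →
    IsAlternating (suc n) D → ∀ u (κ : Vector Carrier w → Carrier) rs →
    D (u ∷ Vec.map (λ r i → r i + κ r * u i) rs) ≈ D (u ∷ rs)
  alternating-shear zero D-alt u κ [] = refl
  alternating-shear (suc n) {D} D-alt@(lin , alt , lift rep) u κ (r ∷ rs) = begin
    D (u ∷ r′ ∷ φrs)                                       ≈⟨ +-hom (proj₁ (alt u) φrs) _ _ ⟩
    D (u ∷ r ∷ φrs) + D (u ∷ (λ i → κ r * u i) ∷ φrs)      ≈⟨ +-congˡ (*-hom (proj₁ (alt u) φrs) _ _) ⟩
    D (u ∷ r ∷ φrs) + κ r * D (u ∷ u ∷ φrs)                ≈⟨ +-congˡ (*-congˡ (rep u φrs)) ⟩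
    D (u ∷ r ∷ φrs) + κ r * 0#                             ≈⟨ solve 2 (λ x y → x :+ y :* con (+ 0) := x) refl (D (u ∷ r ∷ φrs)) (κ r) ⟩
    D (u ∷ r ∷ φrs)                                        ≈⟨ swap u r φrs ⟩
    - D (r ∷ u ∷ φrs)                                      ≈⟨ -‿cong (alternating-shear n (alt r) u κ rs) ⟩
    - D (r ∷ u ∷ rs)                                       ≈⟨ swap u r rs ⟨
    D (u ∷ r ∷ rs)                                         ∎
    where
    open Swap {D = D} D-alt
    φrs = Vec.map (λ r i → r i + κ r * u i) rs
    r′ : Vector Carrier _
    r′ i = r i + κ r * u i

  alternating-cong : ∀ {w} n {D : Vec (Vector Carrier w) n → Carrier} → IsAlternating n D →
    ∀ {rs ss} → (∀ i → Vec.lookup rs i ≋ Vec.lookup ss i) → D rs ≈ D ss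
  alternating-cong zero    D-alt {[]}     {[]}     rs≋ss = refl
  alternating-cong (suc n) (lin , alt , _) {r ∷ rs} {s ∷ ss} rs≋ss =
    trans (cong (lin rs) (rs≋ss zero)) (alternating-cong n (alt s) (rs≋ss ∘ suc))

  rows : ∀ {n w} → (Fin n → Vector Carrier w) → Vec (Vector Carrier w) n
  rows = Vec.tabulate

  lookup-rows : ∀ {n w} (M : Fin n → Vector Carrier w) i → Vec.lookup (rows M) i ≋ M i
  lookup-rows M i j = reflexive (≡.cong (λ r → r j) (Vecₚ.lookup∘tabulate M i))

  lookup-map : ∀ {n w w′} (L : Vector Carrier w → Vector Carrier w′) (rs : Vec (Vector Carrier w) n) i →
               Vec.lookup (Vec.map L rs) i ≋ L (Vec.lookup rs i)
  lookup-map L rs i j = reflexive (≡.cong (λ r → r j) (Vecₚ.lookup-map i L rs))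

  lookup-map-rows : ∀ {n w w′} (L : Vector Carrier w → Vector Carrier w′) (M : Fin n → Vector Carrier w) i →
                    Vec.lookup (Vec.map L (rows M)) i ≋ L (M i)
  lookup-map-rows L M i j = reflexive (≡.cong (λ r → r j)
    (≡.trans (Vecₚ.lookup-map i L (rows M)) (≡.cong L (Vecₚ.lookup∘tabulate M i))))

  -- Moving e_j past the first j unit vectors.
  alternating-cycle : ∀ {n} {D : Vec (Vector Carrier (suc n)) (suc n) → Carrier} →
    IsAlternating (suc n) D → ∀ j →
    D (δ j ∷ Vec.map (λ u → insertAt u j 0#) (rows δ)) ≈ sign j * D (rows δ)
  alternating-cycle {n} {D} D-alt@(_ , alt , _) zero =
    trans (alternating-cong n (alt (δ zero)) λ i j →
             trans (lookup-map-rows extend δ i j) (trans (extend-δ i j) (sym (lookup-rows (δ ∘ suc) i j))))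
          (sym (*-identityˡ _))
  alternating-cycle {suc n} {D} D-alt@(_ , alt , _) (suc j) = begin
    D (δ (suc j) ∷ Vec.map (λ u → insertAt u (suc j) 0#) (rows δ))
      ≈⟨ alternating-cong (suc n) (alt _) same ⟩
    D (δ (suc j) ∷ δ zero ∷ es)
      ≈⟨ Swap.swap {D = D} D-alt _ _ _ ⟩
    - D (δ zero ∷ δ (suc j) ∷ es)
      ≈⟨ -‿cong (alternating-cong (suc n) (alt _) same′) ⟩
    - D (δ zero ∷ Vec.map extend (δ j ∷ Vec.map (λ u → insertAt u j 0#) (rows δ)))
      -- With `δ zero` fixed in front and the other rows pulled back along `extend`, the form has
      -- one row and one coordinate fewer.
      ≈⟨ -‿cong (alternating-cycle {D = λ rs → D (δ zero ∷ Vec.map extend rs)}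
           (alternating-∘ (suc n) (insertAt-linear zero) (alt (δ zero))) j) ⟩
    - (sign j * D (δ zero ∷ Vec.map extend (rows δ)))
      ≈⟨ -‿cong (*-congˡ (alternating-cong (suc n) (alt _) same″)) ⟩
    - (sign j * D (rows δ))
      ≈⟨ solve 2 (λ s d → :- (s :* d) := ((:- con (+ 1)) :* s) :* d) refl (sign j) (D (rows δ)) ⟩
    sign (suc j) * D (rows δ) ∎
    where
    es : Vec (Vector Carrier (suc (suc n))) n
    es = rows (λ i → extend (insertAt (δ i) j 0#))
    same : ∀ i → Vec.lookup (Vec.map (λ u → insertAt u (suc j) 0#) (rows δ)) i ≋ Vec.lookup (δ zero ∷ es) i
    same zero    zero    = refl
    same zero    (suc l) = insert-0 j l
      where
      insert-0 : ∀ {m} (j : Fin (suc m)) → insertAt (λ _ → 0#) j 0# ≋ λ _ → 0#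
      insert-0 {zero}  zero    zero    = refl
      insert-0 {suc m} zero    zero    = refl
      insert-0 {suc m} zero    (suc l) = refl
      insert-0 {suc m} (suc j) zero    = refl
      insert-0 {suc m} (suc j) (suc l) = insert-0 j l
    same (suc i) l = trans (lookup-map-rows (λ u → insertAt u (suc j) 0#) (δ ∘ suc) i l)
      (trans (eq l) (sym (lookup-rows (λ i → extend (insertAt (δ i) j 0#)) i l)))
      where
      eq : insertAt (δ (suc i)) (suc j) 0# ≋ extend (insertAt (δ i) j 0#)
      eq zero    = refl
      eq (suc l) = refl
    same′ : ∀ i → Vec.lookup (δ (suc j) ∷ es) i ≋
                  Vec.lookup (Vec.map extend (δ j ∷ Vec.map (λ u → insertAt u j 0#) (rows δ))) i
    same′ zero    zero    = refl
    same′ zero    (suc l) = refl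
    same′ (suc i) l = trans (lookup-rows (λ i → extend (insertAt (δ i) j 0#)) i l)
      (sym (trans (lookup-map extend (Vec.map (λ u → insertAt u j 0#) (rows δ)) i l)
                  (insert-≋ zero (lookup-map-rows (λ u → insertAt u j 0#) δ i) l)))
    same″ : ∀ i → Vec.lookup (Vec.map extend (rows δ)) i ≋ Vec.lookup (rows (δ ∘ suc)) i
    same″ i l = trans (lookup-map-rows extend δ i l) (trans (extend-δ i l) (sym (lookup-rows (δ ∘ suc) i l)))

  -- Reproduces the Laplace expansion. By linearity the first row becomes a unit vector `δ j`;
  -- shearing by it clears column `j` of the other rows, which then come from vectors with that
  -- column removed, so the induction hypothesis yields the minor. Moving `δ j` back to its place
  -- among the unit vectors yields the sign.
  alternating-unique : ∀ n {D : Vec (Vector Carrier n) n → Carrier} → IsAlternating n D →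
    ∀ rs → D rs ≈ Det (Vec.lookup rs) * D (rows δ)
  alternating-unique zero D-alt [] = trans (sym (*-identityˡ _)) (*-congʳ (sym (Det-empty _)))
  alternating-unique (suc n) {D} D-alt@(lin , alt , _) (r ∷ rs) = begin
    D (r ∷ rs)
      ≈⟨ linear-expand (lin rs) r ⟩
    ∑ (λ j → r j * D (δ j ∷ rs))
      ≈⟨ ∑-cong (λ j → trans (*-congˡ (clear j)) (reassoc _ _ _ _)) ⟩
    ∑ (λ j → D (rows δ) * term j)
      ≈⟨ ∑-* _ term ⟨
    D (rows δ) * ∑ term
      ≈⟨ *-congˡ (Det-suc (Vec.lookup (r ∷ rs))) ⟨
    D (rows δ) * Det (Vec.lookup (r ∷ rs))
      ≈⟨ *-comm _ _ ⟩
    Det (Vec.lookup (r ∷ rs)) * D (rows δ) ∎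
    where
    term : Vector Carrier (suc n)
    term j = sign j * r j * Det (λ i l → Vec.lookup rs i (punchIn j l))
    reassoc : ∀ a m s d → a * (m * (s * d)) ≈ d * (s * a * m)
    reassoc = solve 4 (λ a m s d → a :* (m :* (s :* d)) := d :* (s :* a :* m)) refl
    remove : Fin (suc n) → Vector Carrier (suc n) → Vector Carrier n
    remove j u l = u (punchIn j l)
    shear : Fin (suc n) → Vector Carrier (suc n) → Vector Carrier (suc n)
    shear j u i = u i + - u j * δ j i
    insert : Fin (suc n) → Vector Carrier n → Vector Carrier (suc n)
    insert j u = insertAt u j 0#
    cleared : ∀ {m} (j : Fin (suc m)) (u : Vector Carrier (suc m)) →
              (λ i → u i + - u j * δ j i) ≋ insertAt (λ l → u (punchIn j l)) j 0#
    cleared {zero}  zero    u zero    = trans (+-congˡ (*-identityʳ _)) (-‿inverseʳ _)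
    cleared {suc m} zero    u zero    = trans (+-congˡ (*-identityʳ _)) (-‿inverseʳ _)
    cleared {suc m} zero    u (suc i) = trans (+-congˡ (zeroʳ _)) (+-identityʳ _)
    cleared {suc m} (suc j) u zero    = trans (+-congˡ (zeroʳ _)) (+-identityʳ _)
    cleared {suc m} (suc j) u (suc i) = cleared j (tail u) i
    clear : ∀ j → D (δ j ∷ rs) ≈
            Det (λ i l → Vec.lookup rs i (punchIn j l)) * (sign j * D (rows δ))
    clear j = begin
      D (δ j ∷ rs)
        ≈⟨ alternating-shear n D-alt (δ j) (λ u → - u j) rs ⟨
      D (δ j ∷ Vec.map (shear j) rs)
        ≈⟨ alternating-cong n (alt (δ j)) (λ i l → trans (lookup-map (shear j) rs i l)
             (trans (cleared j (Vec.lookup rs i) l) (sym (trans (lookup-map (insert j) (Vec.map (remove j) rs) i l)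
               (insert-≋ j (lookup-map (remove j) rs i) l))))) ⟩
      D (δ j ∷ Vec.map (insert j) (Vec.map (remove j) rs))
        ≈⟨ alternating-unique n {λ ss → D (δ j ∷ Vec.map (insert j) ss)}
             (alternating-∘ n (insertAt-linear j) (alt (δ j))) (Vec.map (remove j) rs) ⟩
      Det (Vec.lookup (Vec.map (remove j) rs)) * D (δ j ∷ Vec.map (insert j) (rows δ))
        ≈⟨ *-cong (Det-cong (lookup-map (remove j) rs))
                  (alternating-cycle D-alt j) ⟩
      Det (λ i l → Vec.lookup rs i (punchIn j l)) * (sign j * D (rows δ)) ∎

  -- The terms of the expansion along two equal rows r cancel in pairs:
  -- the columns p < q are met once in either order, with opposite signs.
  expand-twice : ∀ {n} (r : Vector Carrier (suc (suc n))) (g : (Fin n → Fin (suc (suc n))) → Carrier) →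
    (∀ {σ τ} → (∀ i → σ i ≡ τ i) → g σ ≈ g τ) →
    ∑ (λ j → sign j * r j * ∑ (λ l → sign l * r (punchIn j l) * g (punchIn j ∘ punchIn l))) ≈ 0#
  expand-twice {n} r g g-cong = begin
    ∑ (λ j → sign j * r j * ∑ (λ l → sign l * r (punchIn j l) * g (punchIn j ∘ punchIn l)))
      ≈⟨ ∑-suc _ ⟩
    1# * r zero * ∑ (λ l → sign l * r (suc l) * g (suc ∘ punchIn l))
      + ∑ (λ j → sign (suc j) * r (suc j) *
          ∑ (λ l → sign l * r (punchIn (suc j) l) * g (punchIn (suc j) ∘ punchIn l)))
      -- Pairs containing column `zero` are split off. They occur as (`zero`, `suc j`) and as
      -- (`suc j`, `zero`) and leave the same columns over, since `punchIn (suc j) ∘ punchIn zero`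
      -- is `suc ∘ punchIn j`.
      ≈⟨ +-cong (∑-* _ _) (∑-cong λ j → trans
           (*-congˡ (trans (∑-suc _) (+-congʳ (*-congˡ (g-cong λ _ → ≡.refl)))))
           (distribˡ _ _ _)) ⟩
    ∑ (λ l → 1# * r zero * (sign l * r (suc l) * g (suc ∘ punchIn l)))
      + ∑ (λ j → sign (suc j) * r (suc j) * (1# * r zero * g (suc ∘ punchIn j))
               + sign (suc j) * r (suc j) * rest j)
      ≈⟨ +-congˡ (∑-+ _ _) ⟩
    ∑ (λ l → 1# * r zero * (sign l * r (suc l) * g (suc ∘ punchIn l)))
      + (∑ (λ j → sign (suc j) * r (suc j) * (1# * r zero * g (suc ∘ punchIn j)))
      + ∑ (λ j → sign (suc j) * r (suc j) * rest j))
      ≈⟨ +-assoc _ _ _ ⟨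
    ∑ (λ l → 1# * r zero * (sign l * r (suc l) * g (suc ∘ punchIn l)))
      + ∑ (λ j → sign (suc j) * r (suc j) * (1# * r zero * g (suc ∘ punchIn j)))
      + ∑ (λ j → sign (suc j) * r (suc j) * rest j)
      ≈⟨ +-cong (trans (sym (∑-+ _ _)) (∑-zero λ j → cancel _ _ _ _)) (remainder n r g g-cong) ⟩
    0# + 0#
      ≈⟨ +-identityˡ 0# ⟩
    0# ∎
    where
    rest : Fin (suc n) → Carrier
    rest j = ∑ (λ l → sign (suc l) * r (punchIn (suc j) (suc l)) * g (punchIn (suc j) ∘ punchIn (suc l)))
    cancel : ∀ s a b x → 1# * a * (s * b * x) + (- 1#) * s * b * (1# * a * x) ≈ 0#
    cancel = solve 4 (λ s a b x → con (+ 1) :* a :* (s :* b :* x) :+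
      (:- con (+ 1)) :* s :* b :* (con (+ 1) :* a :* x) := con (+ 0)) refl
    remainder : ∀ n (r : Vector Carrier (suc (suc n))) (g : (Fin n → Fin (suc (suc n))) → Carrier) →
      (∀ {σ τ} → (∀ i → σ i ≡ τ i) → g σ ≈ g τ) →
      ∑ (λ j → sign (suc j) * r (suc j) *
        ∑ (λ l → sign (suc l) * r (punchIn (suc j) (suc l)) * g (punchIn (suc j) ∘ punchIn (suc l)))) ≈ 0#
    remainder zero    r g g-cong = ∑-zero λ j → trans (*-congˡ (∑-empty _)) (zeroʳ _)
    -- Pairs avoiding column `zero` form the same double sum for `tail r`, with column `zero` kept
    -- among the remaining ones by `lift⁺`. Each of the two signs changes once, so the changes
    -- cancel.
    remainder (suc n) r g g-cong = trans
      (∑-cong λ j → trans (*-congˡ (trans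
          (∑-cong λ l → trans (*-congˡ (g-cong (lifted j l))) (pull _ _ _))
          (sym (∑-* _ _))))
        (signs _ _ _))
      (expand-twice (tail r) (g ∘ lift⁺) λ σ≗τ → g-cong λ { zero → ≡.refl ; (suc i) → ≡.cong suc (σ≗τ i) })
      where
      lift⁺ : ∀ {m m′} → (Fin m → Fin m′) → Fin (suc m) → Fin (suc m′)
      lift⁺ σ zero    = zero
      lift⁺ σ (suc i) = suc (σ i)
      lifted : ∀ j l i → punchIn (suc j) (punchIn (suc l) i) ≡ lift⁺ (punchIn j ∘ punchIn l) i
      lifted j l zero    = ≡.refl
      lifted j l (suc i) = ≡.refl
      pull : ∀ s a x → (- 1#) * s * a * x ≈ (- 1#) * (s * a * x)
      pull = solve 3 (λ s a x → (:- con (+ 1)) :* s :* a :* x := (:- con (+ 1)) :* (s :* a :* x)) refl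
      signs : ∀ s a x → (- 1#) * s * a * ((- 1#) * x) ≈ s * a * x
      signs = solve 3 (λ s a x → (:- con (+ 1)) :* s :* a :* ((:- con (+ 1)) :* x) := s :* a :* x) refl

  linear-resp : ∀ {w} {f g : Vector Carrier w → Carrier} → (∀ u → f u ≈ g u) → IsLinear g → IsLinear f
  linear-resp f≈g g-lin = record
    { cong  = λ u≋v → trans (f≈g _) (trans (cong g-lin u≋v) (sym (f≈g _)))
    ; +-hom = λ u v → trans (f≈g _) (trans (+-hom g-lin u v) (sym (+-cong (f≈g u) (f≈g v))))
    ; *-hom = λ a u → trans (f≈g _) (trans (*-hom g-lin a u) (sym (*-congˡ (f≈g u))))
    }

  alternating-resp : ∀ {w} n {D E : Vec (Vector Carrier w) n → Carrier} → (∀ rs → D rs ≈ E rs) →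
                     IsAlternating n E → IsAlternating n D
  alternating-resp zero          D≈E _ = lift tt
  alternating-resp (suc zero)    D≈E (lin , _ , _) =
    (λ rs → linear-resp (λ r → D≈E _) (lin rs)) , (λ r → lift tt) , lift tt
  alternating-resp (suc (suc n)) D≈E (lin , alt , lift rep) =
    (λ rs → linear-resp (λ r → D≈E _) (lin rs)) ,
    (λ r → alternating-resp (suc n) (λ rs → D≈E _) (alt r)) ,
    lift λ r rs → trans (D≈E _) (rep r rs)

  -- The column selection `σ` makes the induction possible: minors lose columns while the rows keep
  -- their full length, so a minor is the same function with `σ ∘ punchIn j`.
  Det-alternating : ∀ n {w} (σ : Fin n → Fin w) →
    IsAlternating n (λ rs → Det (λ i l → Vec.lookup rs i (σ l)))
  Det-alternating zero σ = lift tt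
  Det-alternating (suc n) {w} σ = alternating-resp (suc n) {E = E {n} {σ}} (λ { (r ∷ rs) → Det-suc _ })
    ( (λ rs → record
      { cong  = λ u≋v → ∑-cong λ j → *-congʳ (*-congˡ (u≋v (σ j)))
      ; +-hom = λ u v → trans (∑-cong λ j → additive _ _ _ _) (∑-+ _ _)
      ; *-hom = λ a u → trans (∑-cong λ j → homogeneous _ _ _ _) (sym (∑-* a _))
      })
    , (λ r → alternating-sum n (λ j → sign j * r (σ j)) (λ j → Det-alternating n (σ ∘ punchIn j)))
    , repeat n σ)
    where
    E : ∀ {n} {σ : Fin (suc n) → Fin w} → Vec (Vector Carrier w) (suc n) → Carrier
    E {σ = σ} (r ∷ rs) = ∑ (λ j → sign j * r (σ j) * Det (λ i l → Vec.lookup rs i (σ (punchIn j l))))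
    additive : ∀ s a b x → s * (a + b) * x ≈ s * a * x + s * b * x
    additive = solve 4 (λ s a b x → s :* (a :+ b) :* x := s :* a :* x :+ s :* b :* x) refl
    homogeneous : ∀ s a b x → s * (a * b) * x ≈ a * (s * b * x)
    homogeneous = solve 4 (λ s a b x → s :* (a :* b) :* x := a :* (s :* b :* x)) refl
    repeat : ∀ n (σ : Fin (suc n) → Fin w) → VanishesOnRepeat (E {n} {σ})
    repeat zero    σ = lift tt
    repeat (suc n) σ = lift λ r rs → trans
      (∑-cong λ j → *-congˡ (Det-suc _))
      (expand-twice (r ∘ σ)
        (λ τ → Det (λ i l → Vec.lookup rs i (σ (τ l))))
        (λ σ≗τ → Det-cong λ i l → reflexive (≡.cong (λ k → Vec.lookup rs i (σ k)) (σ≗τ l))))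

  infixl 7 _⊡_
  _⊡_ : ∀ {n} → Matrix Carrier n → Matrix Carrier n → Matrix Carrier n
  (M ⊡ N) i j = ∑ (λ l → M i l * N l j)

  δ-sum : ∀ {n} (i : Fin n) (u : Vector Carrier n) → ∑ (λ l → δ i l * u l) ≈ u i
  δ-sum zero    u = trans (∑-suc _) (trans (+-cong (*-identityˡ _) (∑-zero λ l → zeroˡ _)) (+-identityʳ _))
  δ-sum (suc i) u = trans (∑-suc _) (trans (+-cong (zeroˡ _) (δ-sum i (tail u))) (+-identityˡ _))

  -- As a function of the rows of `M`, the left side is an alternating form, whose value at the
  -- identity is `Det N`.
  Det-⊡ : ∀ {n} (M N : Matrix Carrier n) → Det (M ⊡ N) ≈ Det M * Det N
  Det-⊡ {n} M N = begin
    Det (M ⊡ N)                                                  ≈⟨ Det-cong (lookup-map-rows act M) ⟨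
    D (rows M)                                                     ≈⟨ alternating-unique n {D} D-alt (rows M) ⟩
    Det (Vec.lookup (rows M)) * D (rows δ)                       ≈⟨ *-cong (Det-cong (lookup-rows M))
      (Det-cong λ i j → trans (lookup-map-rows act δ i j) (δ-sum i (λ l → N l j))) ⟩
    Det M * Det N                                              ∎
    where
    act : Vector Carrier n → Vector Carrier n
    act u j = ∑ (λ l → u l * N l j)
    D : Vec (Vector Carrier n) n → Carrier
    D rs = Det (Vec.lookup (Vec.map act rs))
    act-linear : IsLinearMap act
    act-linear = record
      { Lcong  = λ u≋v j → ∑-cong λ l → *-congʳ (u≋v l)
      ; L+-hom = λ u v j → trans (∑-cong λ l → distribʳ _ _ _) (∑-+ _ _)
      ; L*-hom = λ a u j → trans (∑-cong λ l → *-assoc _ _ _) (sym (∑-* a _))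
      }
    D-alt : IsAlternating n D
    D-alt = alternating-∘ n {D = λ rs → Det (Vec.lookup rs)} act-linear (Det-alternating n (λ l → l))

-- Order, finite sums and inner products over an undecidable order

module Order {c ℓ₁ ℓ₂} (ℝ : RealNumbers c ℓ₁ ℓ₂) where
  open RealNumbers ℝ
  open CommutativeRing commutativeRing using (ring; semiring)
  open RingProperties ring
  open MultProperties semiring using (×-homo-+; ×1-homo-*)
  open HeytingProperties heytingCommutativeRing using (1#0; x-0≈x)
  open IntegerCoefficients commutativeRing
  open Determinants ℝ
  private module SPO = IsStrictPartialOrder isStrictPartialOrder

  <⇒# : ∀ {x y} → x < y → x # y
  <⇒# x<y = Equivalence.from #⇔<⊎> (inj₁ x<y)

  -- The substitute for trichotomy, inherited from the apartness relation. The outcomes `z < x` and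
  -- `y < z`, in which `z` lies outside the interval, are absorbed by transitivity.
  <-cotrans : ∀ {x y} → x < y → ∀ z → x < z ⊎ z < y
  <-cotrans x<y z with #-cotrans (<⇒# x<y) z
  ... | inj₁ x#z with Equivalence.to #⇔<⊎> x#z
  ...   | inj₁ x<z = inj₁ x<z
  ...   | inj₂ z<x = inj₂ (SPO.trans z<x x<y)
  <-cotrans x<y z | inj₂ z#y with Equivalence.to #⇔<⊎> z#y
  ...   | inj₁ z<y = inj₂ z<y
  ...   | inj₂ y<z = inj₁ (SPO.trans x<y y<z)

  <⇒≤ : ∀ {x y} → x < y → x ≤ y
  <⇒≤ = SPO.asym

  ≤-trans : ∀ {x y z} → x ≤ y → y ≤ z → x ≤ z
  ≤-trans {y = y} x≤y y≤z z<x with <-cotrans z<x y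
  ... | inj₁ z<y = y≤z z<y
  ... | inj₂ y<x = x≤y y<x

  <-≤-trans : ∀ {x y z} → x < y → y ≤ z → x < z
  <-≤-trans {z = z} x<y y≤z with <-cotrans x<y z
  ... | inj₁ x<z = x<z
  ... | inj₂ z<y = contradiction z<y y≤z

  ≤-<-trans : ∀ {x y z} → x ≤ y → y < z → x < z
  ≤-<-trans {x} x≤y y<z with <-cotrans y<z x
  ... | inj₁ y<x = contradiction y<x x≤y
  ... | inj₂ x<z = x<z

  ≤-reflexive : ∀ {x y} → x ≈ y → x ≤ y
  ≤-reflexive x≈y = SPO.irrefl (sym x≈y)

  ≤-antisym : ∀ {x y} → x ≤ y → y ≤ x → x ≈ y
  ≤-antisym {x} {y} x≤y y≤x = proj₁ (tight x y) λ x#y → distinct (Equivalence.to #⇔<⊎> x#y)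
    where
    distinct : ¬ (x < y ⊎ y < x)
    distinct (inj₁ x<y) = y≤x x<y
    distinct (inj₂ y<x) = x≤y y<x

  ≤-isPreorder : IsPreorder _≈_ _≤_
  ≤-isPreorder = record
    { isEquivalence = isEquivalence ; reflexive = ≤-reflexive ; trans = ≤-trans }

  module ≤-Reasoning = TripleReasoning ≤-isPreorder SPO.asym SPO.trans SPO.<-resp-≈ <⇒≤ <-≤-trans ≤-<-trans
  open ≤-Reasoning

  -- Classical case distinctions are available since x ≤ y is a negation.
  0≤-cases : ∀ {x p} {P : Set p} → 0# ≤ x → (x ≈ 0# → ¬ P) → (0# < x → ¬ P) → ¬ P
  0≤-cases 0≤x zero-case pos-case P =
    zero-case (≤-antisym (λ 0<x → pos-case 0<x P) 0≤x) P

  +-monoʳ-< : ∀ z {x y} → x < y → z + x < z + y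
  +-monoʳ-< z x<y = proj₁ SPO.<-resp-≈ (+-comm _ _) (proj₂ SPO.<-resp-≈ (+-comm _ _) (+-monoˡ-< z x<y))

  x<y⇒0<y-x : ∀ {x y} → x < y → 0# < y - x
  x<y⇒0<y-x {x} {y} x<y = begin-strict
    0#     ≈⟨ -‿inverseʳ x ⟨
    x - x  <⟨ +-monoˡ-< (- x) x<y ⟩
    y - x  ∎

  0<y-x⇒x<y : ∀ {x y} → 0# < y - x → x < y
  0<y-x⇒x<y {x} {y} 0<y-x = begin-strict
    x          ≈⟨ +-identityˡ x ⟨
    0# + x     <⟨ +-monoˡ-< x 0<y-x ⟩
    y - x + x  ≈⟨ solve 2 (λ x y → y :- x :+ x := y) refl x y ⟩
    y          ∎

  +-mono-≤ : ∀ {x y u v} → x ≤ y → u ≤ v → x + u ≤ y + v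
  +-mono-≤ {x} {y} {u} {v} x≤y u≤v y+v<x+u = u≤v (begin-strict
    v              ≈⟨ solve 2 (λ y v → v := :- y :+ (y :+ v)) refl y v ⟩
    - y + (y + v)  <⟨ +-monoʳ-< (- y) y+v<x+u ⟩
    - y + (x + u)  ≤⟨ (λ lt → x≤y (begin-strict
      y                        ≈⟨ solve 2 (λ y u → y := y :- u :+ u) refl y u ⟩
      y - u + u                <⟨ +-monoʳ-< (y - u) lt ⟩
      y - u + (- y + (x + u))  ≈⟨ solve 3 (λ x y u → y :- u :+ (:- y :+ (x :+ u)) := x) refl x y u ⟩
      x                        ∎)) ⟩
    u              ∎)

  x≤y⇒0≤y-x : ∀ {x y} → x ≤ y → 0# ≤ y - x
  x≤y⇒0≤y-x {x} {y} x≤y = begin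
    0#     ≈⟨ -‿inverseʳ x ⟨
    x - x  ≤⟨ +-mono-≤ x≤y (≤-reflexive refl) ⟩
    y - x  ∎

  0≤y-x⇒x≤y : ∀ {x y} → 0# ≤ y - x → x ≤ y
  0≤y-x⇒x≤y {x} {y} 0≤y-x = begin
    x          ≈⟨ +-identityˡ x ⟨
    0# + x     ≤⟨ +-mono-≤ 0≤y-x (≤-reflexive refl) ⟩
    y - x + x  ≈⟨ solve 2 (λ x y → y :- x :+ x := y) refl x y ⟩
    y          ∎

  0≤+ : ∀ {x y} → 0# ≤ x → 0# ≤ y → 0# ≤ x + y
  0≤+ {x} {y} 0≤x 0≤y = begin
    0#       ≈⟨ +-identityˡ 0# ⟨
    0# + 0#  ≤⟨ +-mono-≤ 0≤x 0≤y ⟩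
    x + y    ∎

  0≤* : ∀ {x y} → 0# ≤ x → 0# ≤ y → 0# ≤ x * y
  0≤* {x} {y} 0≤x 0≤y = 0≤-cases 0≤x
    (λ x≈0 → ≤-reflexive (sym (trans (*-congʳ x≈0) (zeroˡ y))))
    λ 0<x → 0≤-cases 0≤y
      (λ y≈0 → ≤-reflexive (sym (trans (*-congˡ y≈0) (zeroʳ x))))
      λ 0<y → <⇒≤ (*-pos 0<x 0<y)

  *-monoʳ-≤ : ∀ {z x y} → 0# ≤ z → x ≤ y → z * x ≤ z * y
  *-monoʳ-≤ {z} {x} {y} 0≤z x≤y = 0≤y-x⇒x≤y (begin
    0#             ≤⟨ 0≤* 0≤z (x≤y⇒0≤y-x x≤y) ⟩
    z * (y - x)    ≈⟨ x[y-z]≈xy-xz z y x ⟩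
    z * y - z * x  ∎)

  *-mono-≤ : ∀ {x y u v} → 0# ≤ x → 0# ≤ u → x ≤ y → u ≤ v → x * u ≤ y * v
  *-mono-≤ {x} {y} {u} {v} 0≤x 0≤u x≤y u≤v = begin
    x * u  ≤⟨ *-monoʳ-≤ 0≤x u≤v ⟩
    x * v  ≈⟨ *-comm x v ⟩
    v * x  ≤⟨ *-monoʳ-≤ (≤-trans 0≤u u≤v) x≤y ⟩
    v * y  ≈⟨ *-comm v y ⟩
    y * v  ∎

  *-monoʳ-< : ∀ {z x y} → 0# < z → x < y → z * x < z * y
  *-monoʳ-< {z} {x} {y} 0<z x<y = 0<y-x⇒x<y (begin-strict
    0#             <⟨ *-pos 0<z (x<y⇒0<y-x x<y) ⟩
    z * (y - x)    ≈⟨ x[y-z]≈xy-xz z y x ⟩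
    z * y - z * x  ∎)

  *-cancelˡ-≤ : ∀ {z x y} → 0# < z → z * x ≤ z * y → x ≤ y
  *-cancelˡ-≤ 0<z zx≤zy y<x = zx≤zy (*-monoʳ-< 0<z y<x)

  -- A negative square refutes both `0# < x` and `x < 0#`. Antisymmetry then gives `x ≈ 0#` without
  -- the sign of `x` ever being decided.
  0≤x*x : ∀ x → 0# ≤ x * x
  0≤x*x x xx<0 = SPO.irrefl (trans (*-congʳ x≈0) (zeroˡ x)) xx<0
    where
    x≈0 : x ≈ 0#
    x≈0 = ≤-antisym
      (λ 0<x → SPO.asym (*-pos 0<x 0<x) xx<0)
      (λ x<0 → let 0<-x = proj₁ SPO.<-resp-≈ (+-identityˡ _) (x<y⇒0<y-x x<0) in
        SPO.asym (proj₁ SPO.<-resp-≈ (solve 1 (λ x → :- x :* :- x := x :* x) refl x) (*-pos 0<-x 0<-x)) xx<0)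

  0<1 : 0# < 1#
  0<1 with Equivalence.to #⇔<⊎> 1#0
  ... | inj₁ 1<0 = contradiction (proj₂ SPO.<-resp-≈ (sym (*-identityˡ 1#)) 1<0) (0≤x*x 1#)
  ... | inj₂ 0<1 = 0<1

  0≤^ : ∀ {x} j → 0# ≤ x → 0# ≤ x ^ j
  0≤^ zero    0≤x = <⇒≤ 0<1
  0≤^ (suc j) 0≤x = 0≤* 0≤x (0≤^ j 0≤x)

  square-mono⁻¹-≤ : ∀ {x y} → 0# ≤ y → x * x ≤ y * y → x ≤ y
  square-mono⁻¹-≤ {x} {y} 0≤y xx≤yy y<x = xx≤yy (begin-strict
    y * y  ≤⟨ *-monoʳ-≤ 0≤y (<⇒≤ y<x) ⟩
    y * x  ≈⟨ *-comm y x ⟩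
    x * y  <⟨ *-monoʳ-< (≤-<-trans 0≤y y<x) y<x ⟩
    x * x  ∎)

  neg-mono-≤ : ∀ {x y} → x ≤ y → - y ≤ - x
  neg-mono-≤ {x} {y} x≤y = 0≤y-x⇒x≤y (begin
    0#       ≤⟨ x≤y⇒0≤y-x x≤y ⟩
    y - x    ≈⟨ solve 2 (λ x y → y :- x := :- x :- :- y) refl x y ⟩
    - x - - y ∎)

  0≤ι : ∀ n → 0# ≤ ι n
  0≤ι zero    = ≤-reflexive refl
  0≤ι (suc n) = 0≤+ (<⇒≤ 0<1) (0≤ι n)

  0<ι : ∀ n → 0# < ι (suc n)
  0<ι n = begin-strict
    0#       <⟨ 0<1 ⟩
    1#       ≈⟨ +-identityʳ 1# ⟨
    1# + 0#  ≤⟨ +-mono-≤ (≤-reflexive refl) (0≤ι n) ⟩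
    ι (suc n) ∎

  ι-+ : ∀ m n → ι (m ℕ.+ n) ≈ ι m + ι n
  ι-+ = ×-homo-+ 1#

  ι-* : ∀ m n → ι (m ℕ.* n) ≈ ι m * ι n
  ι-* = ×1-homo-*

  ι-mono-≤ : ∀ {m n} → m ℕ.≤ n → ι m ≤ ι n
  ι-mono-≤ {n = n} ℕ.z≤n     = 0≤ι n
  ι-mono-≤         (ℕ.s≤s p) = +-mono-≤ (≤-reflexive refl) (ι-mono-≤ p)

  ι-mono-< : ∀ {m n} → m ℕ.< n → ι m < ι n
  ι-mono-< {m} {n} m<n = begin-strict
    ι m        ≈⟨ +-identityˡ _ ⟨
    0# + ι m   <⟨ +-monoˡ-< (ι m) 0<1 ⟩
    ι (suc m)  ≤⟨ ι-mono-≤ m<n ⟩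
    ι n        ∎

  /-*-cancel : ∀ x {y} (y#0 : y # 0#) → x / y ⟨ y#0 ⟩ * y ≈ x
  /-*-cancel x {y} y#0 = trans (*-assoc _ _ _) (trans
    (*-congˡ (trans (*-congˡ (sym (x-0≈x y))) (proj₁ (proj₂ (#⇒invertible y#0))))) (*-identityʳ x))

  ∑-mono-≤ : ∀ {n} {f g : Vector Carrier n} → (∀ i → f i ≤ g i) → ∑ f ≤ ∑ g
  ∑-mono-≤ {zero}  f≤g = ≤-reflexive (trans (∑-empty _) (sym (∑-empty _)))
  ∑-mono-≤ {suc n} {f} {g} f≤g = begin
    ∑ f                     ≈⟨ ∑-suc f ⟩
    f zero + ∑ (f ∘ suc)    ≤⟨ +-mono-≤ (f≤g zero) (∑-mono-≤ (f≤g ∘ suc)) ⟩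
    g zero + ∑ (g ∘ suc)    ≈⟨ ∑-suc g ⟨
    ∑ g                     ∎

  0≤∑ : ∀ {n} {f : Vector Carrier n} → (∀ i → 0# ≤ f i) → 0# ≤ ∑ f
  0≤∑ {n} {f} 0≤f = begin
    0#              ≈⟨ ∑-zero (λ _ → refl) ⟨
    ∑ {n} (λ _ → 0#) ≤⟨ ∑-mono-≤ 0≤f ⟩
    ∑ f             ∎

  infix 8 _∙_
  _∙_ : ∀ {n} → Vector Carrier n → Vector Carrier n → Carrier
  u ∙ v = ∑ (λ i → u i * v i)

  ∑-*ʳ : ∀ {n} a (f : Vector Carrier n) → ∑ f * a ≈ ∑ (λ i → f i * a)
  ∑-*ʳ a f = trans (*-comm _ a) (trans (∑-* a f) (∑-cong λ i → *-comm a (f i)))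

  ∑-product : ∀ {m n} (f : Vector Carrier m) (g : Vector Carrier n) →
              ∑ (λ i → ∑ (λ j → f i * g j)) ≈ ∑ f * ∑ g
  ∑-product f g = trans (∑-cong λ i → sym (∑-* (f i) g)) (sym (∑-*ʳ (∑ g) f))

  0≤v∙v : ∀ {n} (v : Vector Carrier n) → 0# ≤ v ∙ v
  0≤v∙v v = 0≤∑ (λ i → 0≤x*x (v i))

  -- Lagrange's identity: twice the gap is the sum of the (uᵢvⱼ - uⱼvᵢ)².
  cauchy-schwarz : ∀ {n} (u v : Vector Carrier n) → u ∙ v * u ∙ v ≤ u ∙ u * v ∙ v
  cauchy-schwarz u v = *-cancelˡ-≤ (0<ι 1) (0≤y-x⇒x≤y (begin
    0#
      ≤⟨ 0≤∑ (λ i → 0≤∑ λ j → 0≤x*x (u i * v j - u j * v i)) ⟩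
    ∑ (λ i → ∑ (λ j → (u i * v j - u j * v i) * (u i * v j - u j * v i)))
      ≈⟨ ∑-cong (λ i → trans (∑-cong λ j → expand (u i) (v i) (u j) (v j))
           (trans (∑-+ _ _) (+-cong (∑-+ _ _) (sym (∑-* _ _))))) ⟩
    ∑ (λ i → (∑ (λ j → (u i * u i) * (v j * v j)) + ∑ (λ j → (v i * v i) * (u j * u j)))
              + - ι 2 * ∑ (λ j → (u i * v i) * (u j * v j)))
      ≈⟨ trans (∑-+ _ _) (+-cong (∑-+ _ _) (sym (∑-* _ _))) ⟩
    (∑ (λ i → ∑ (λ j → (u i * u i) * (v j * v j))) + ∑ (λ i → ∑ (λ j → (v i * v i) * (u j * u j))))
              + - ι 2 * ∑ (λ i → ∑ (λ j → (u i * v i) * (u j * v j)))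
      ≈⟨ +-cong (+-cong (∑-product _ _) (∑-product _ _)) (*-congˡ (∑-product _ _)) ⟩
    u ∙ u * v ∙ v + v ∙ v * u ∙ u + - ι 2 * (u ∙ v * u ∙ v)
      ≈⟨ solve 3 (λ a b c → a :* b :+ b :* a :+ (:- two) :* c := two :* (a :* b) :- two :* c) refl
           (u ∙ u) (v ∙ v) (u ∙ v * u ∙ v) ⟩
    ι 2 * (u ∙ u * v ∙ v) - ι 2 * (u ∙ v * u ∙ v) ∎))
    where
    two : ∀ {n} → Polynomial n
    two {n} = con {n} (+ 1) :+ (con (+ 1) :+ con (+ 0))
    expand : ∀ a b x y → (a * y - x * b) * (a * y - x * b) ≈
             (a * a) * (y * y) + (b * b) * (x * x) + - ι 2 * ((a * b) * (x * y))
    expand = solve 4 (λ a b x y → (a :* y :- x :* b) :* (a :* y :- x :* b) :=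
      (a :* a) :* (y :* y) :+ (b :* b) :* (x :* x) :+ (:- two) :* ((a :* b) :* (x :* y))) refl

-- Polynomial functions and the reversed characteristic polynomial

module Polynomials {c ℓ₁ ℓ₂} (ℝ : RealNumbers c ℓ₁ ℓ₂) where
  open RealNumbers ℝ
  open CommutativeRing commutativeRing using (ring; *-commutativeMonoid)
  open RingProperties ring
  open IntegerCoefficients commutativeRing
  open Determinants ℝ
  open Order ℝ
  private module Prod = MonoidSum *-commutativeMonoid
  open SetoidReasoning setoid

  eval : ∀ {n} → Vec Carrier n → Carrier → Carrier
  eval []       t = 0#
  eval (a ∷ as) t = a + t * eval as t

  -- The number of coefficients is only an upper bound: leading zeros are allowed, because whether a
  -- coefficient vanishes cannot be decided.
  IsPolynomial : (Carrier → Carrier) → Set (c ⊔ˡ ℓ₁)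
  IsPolynomial f = ∃[ n ] ∃[ as ] (∀ t → f t ≈ eval {n} as t)

  poly-resp : ∀ {f g} → (∀ t → f t ≈ g t) → IsPolynomial g → IsPolynomial f
  poly-resp f≈g (n , as , g≈as) = n , as , λ t → trans (f≈g t) (g≈as t)

  poly-const : ∀ a → IsPolynomial (λ _ → a)
  poly-const a = 1 , a ∷ [] , λ t → solve 2 (λ a t → a := a :+ t :* con (+ 0)) refl a t

  poly-t* : ∀ {f} → IsPolynomial f → IsPolynomial (λ t → t * f t)
  poly-t* (n , as , f≈as) = suc n , 0# ∷ as , λ t → trans (*-congˡ (f≈as t)) (sym (+-identityˡ _))

  poly-scale : ∀ a {f} → IsPolynomial f → IsPolynomial (λ t → a * f t)
  poly-scale a (n , as , f≈as) = n , Vec.map (a *_) as , λ t → trans (*-congˡ (f≈as t)) (eval-scale as t)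
    where
    eval-scale : ∀ {n} (as : Vec Carrier n) t → a * eval as t ≈ eval (Vec.map (a *_) as) t
    eval-scale []       t = zeroʳ a
    eval-scale (b ∷ bs) t = trans
      (solve 4 (λ a b t x → a :* (b :+ t :* x) := a :* b :+ t :* (a :* x)) refl a b t (eval bs t))
      (+-congˡ (*-congˡ (eval-scale bs t)))

  poly-+ : ∀ {f g} → IsPolynomial f → IsPolynomial g → IsPolynomial (λ t → f t + g t)
  poly-+ (m , as , f≈as) (n , bs , g≈bs) =
    m ℕ.⊔ n , add as bs , λ t → trans (+-cong (f≈as t) (g≈bs t)) (eval-add as bs t)
    where
    add : ∀ {m n} → Vec Carrier m → Vec Carrier n → Vec Carrier (m ℕ.⊔ n)
    add []       bs       = bs
    add (a ∷ as) []       = a ∷ as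
    add (a ∷ as) (b ∷ bs) = (a + b) ∷ add as bs
    eval-add : ∀ {m n} (as : Vec Carrier m) (bs : Vec Carrier n) t →
               eval as t + eval bs t ≈ eval (add as bs) t
    eval-add []       bs       t = +-identityˡ _
    eval-add (a ∷ as) []       t = +-identityʳ _
    eval-add (a ∷ as) (b ∷ bs) t = trans
      (solve 5 (λ a b t x y → (a :+ t :* x) :+ (b :+ t :* y) := (a :+ b) :+ t :* (x :+ y))
        refl a b t (eval as t) (eval bs t))
      (+-congˡ (*-congˡ (eval-add as bs t)))

  poly-* : ∀ {f g} → IsPolynomial f → IsPolynomial g → IsPolynomial (λ t → f t * g t)
  poly-* {g = g} (m , as , f≈as) g-poly = poly-resp (λ t → *-congʳ (f≈as t)) (eval-* as)
    where
    eval-* : ∀ {m} (as : Vec Carrier m) → IsPolynomial (λ t → eval as t * g t)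
    eval-* []       = poly-resp (λ t → zeroˡ _) (poly-const 0#)
    eval-* (a ∷ as) = poly-resp
      (λ t → solve 4 (λ a t x y → (a :+ t :* x) :* y := a :* y :+ t :* (x :* y)) refl a t (eval as t) (g t))
      (poly-+ (poly-scale a g-poly) (poly-t* (eval-* as)))

  poly-∑ : ∀ {n} {f : Fin n → Carrier → Carrier} → (∀ i → IsPolynomial (f i)) →
           IsPolynomial (λ t → ∑ (λ i → f i t))
  poly-∑ {zero}  f-poly = poly-resp (λ t → ∑-empty _) (poly-const 0#)
  poly-∑ {suc n} f-poly = poly-resp (λ t → ∑-suc _) (poly-+ (f-poly zero) (poly-∑ (f-poly ∘ suc)))

  poly-Det : ∀ {n} {M : Carrier → Matrix Carrier n} → (∀ i j → IsPolynomial (λ t → M t i j)) →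
             IsPolynomial (λ t → Det (M t))
  poly-Det {zero}  M-poly = poly-resp (λ t → Det-empty _) (poly-const 1#)
  poly-Det {suc n} M-poly = poly-resp (λ t → Det-suc _) (poly-∑ λ j →
    poly-* (poly-scale (sign j) (M-poly zero j)) (poly-Det λ i l → M-poly (suc i) (punchIn j l)))

  -- Synthetic division by `t - x`: the Horner values of the successive tails at `x` are the
  -- coefficients of the quotient, and the value of the whole is the remainder.
  quotient : ∀ {n} → Carrier → Vec Carrier (suc n) → Vec Carrier n
  quotient {zero}  x _        = []
  quotient {suc n} x (a ∷ as) = eval as x ∷ quotient x as

  eval-quotient : ∀ {n} x (as : Vec Carrier (suc n)) t →
                  eval as t ≈ eval as x + (t - x) * eval (quotient x as) t
  eval-quotient {zero} x (a ∷ []) t =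
    solve 3 (λ a t x → a :+ t :* con (+ 0) := a :+ x :* con (+ 0) :+ (t :- x) :* con (+ 0)) refl a t x
  eval-quotient {suc n} x (a ∷ as) t = trans
    (+-congˡ (*-congˡ (eval-quotient x as t)))
    (solve 5 (λ a t x p q → a :+ t :* (p :+ (t :- x) :* q) := a :+ x :* p :+ (t :- x) :* (p :+ t :* q))
      refl a t x (eval as x) (eval (quotient x as) t))

  -- The squares 1, 4, 9, … are used as nodes since they are known to be
  -- pairwise apart and to have square roots.
  node : ℕ → Carrier
  node m = ι (suc m) * ι (suc m)

  0<node : ∀ m → 0# < node m
  0<node m = *-pos (0<ι m) (0<ι m)

  node-mono-< : ∀ {m n} → m ℕ.< n → node m < node n
  node-mono-< {m} {n} m<n = ≤-<-trans
    (≤-reflexive (*-comm _ _))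
    (≤-<-trans (*-monoʳ-≤ (0≤ι (suc m)) (<⇒≤ m<n′))
      (≤-<-trans (≤-reflexive (*-comm _ _)) (*-monoʳ-< (0<ι n) m<n′)))
    where
    m<n′ : ι (suc m) < ι (suc n)
    m<n′ = ι-mono-< (ℕ.s≤s m<n)

  x*y≈0⇒y≈0 : ∀ {x y} → 0# < x → x * y ≈ 0# → y ≈ 0#
  x*y≈0⇒y≈0 0<x xy≈0 = ≤-antisym
    (*-cancelˡ-≤ 0<x (≤-reflexive (trans xy≈0 (sym (zeroʳ _)))))
    (*-cancelˡ-≤ 0<x (≤-reflexive (trans (zeroʳ _) (sym xy≈0))))

  -- One root is divided out per step, shortening the list, and `k` marks the first node not yet
  -- used. Later nodes are strictly larger, so the factor `node m - node k` is positive and cancels.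
  eval-vanishes : ∀ {n} (as : Vec Carrier n) k → (∀ m → k ℕ.≤ m → eval as (node m) ≈ 0#) →
                  ∀ t → eval as t ≈ 0#
  eval-vanishes {zero}  []  k roots t = refl
  eval-vanishes {suc n} as k roots t = begin
    eval as t
      ≈⟨ eval-quotient (node k) as t ⟩
    eval as (node k) + (t - node k) * eval (quotient (node k) as) t
      ≈⟨ +-cong (roots k ℕₚ.≤-refl) (*-congˡ (eval-vanishes (quotient (node k) as) (suc k) roots′ t)) ⟩
    0# + (t - node k) * 0#
      ≈⟨ trans (+-identityˡ _) (zeroʳ _) ⟩
    0# ∎
    where
    roots′ : ∀ m → suc k ℕ.≤ m → eval (quotient (node k) as) (node m) ≈ 0#
    roots′ m k<m = x*y≈0⇒y≈0 (x<y⇒0<y-x (node-mono-< k<m)) (begin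
      (node m - node k) * eval (quotient (node k) as) (node m)
        ≈⟨ +-identityˡ _ ⟨
      0# + (node m - node k) * eval (quotient (node k) as) (node m)
        ≈⟨ +-congʳ (roots k ℕₚ.≤-refl) ⟨
      eval as (node k) + (node m - node k) * eval (quotient (node k) as) (node m)
        ≈⟨ eval-quotient (node k) as (node m) ⟨
      eval as (node m)
        ≈⟨ roots m (ℕₚ.<⇒≤ k<m) ⟩
      0# ∎)

  poly-ext : ∀ {f g} → IsPolynomial f → IsPolynomial g → (∀ m → f (node m) ≈ g (node m)) →
             ∀ t → f t ≈ g t
  poly-ext {f} {g} f-poly g-poly f≈g t = begin
    f t                        ≈⟨ solve 2 (λ x y → x := x :+ (:- con (+ 1)) :* y :+ y) refl (f t) (g t) ⟩
    f t + - 1# * g t + g t     ≈⟨ +-congʳ (trans (h≈as t) (eval-vanishes as 0 (λ m _ → root m) t)) ⟩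
    0# + g t                   ≈⟨ +-identityˡ _ ⟩
    g t                        ∎
    where
    h-poly : IsPolynomial (λ t → f t + - 1# * g t)
    h-poly = poly-+ f-poly (poly-scale (- 1#) g-poly)
    as = proj₁ (proj₂ h-poly)
    h≈as = proj₂ (proj₂ h-poly)
    root : ∀ m → eval as (node m) ≈ 0#
    root m = trans (sym (h≈as (node m))) (trans (+-congʳ (f≈g m))
      (solve 1 (λ y → y :+ (:- con (+ 1)) :* y := con (+ 0)) refl (g (node m))))

  opaque
    ∏ : ∀ {n} → Vector Carrier n → Carrier
    ∏ f = product f

  opaque
    unfolding ∏

    ∏≡product : ∀ {n} (f : Vector Carrier n) → ∏ f ≡ product f
    ∏≡product f = ≡.refl

    ∏-empty : (f : Vector Carrier 0) → ∏ f ≈ 1#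
    ∏-empty f = refl

    ∏-suc : ∀ {n} (f : Vector Carrier (suc n)) → ∏ f ≈ f zero * ∏ (f ∘ suc)
    ∏-suc f = refl

    ∏-cong : ∀ {n} {f g : Vector Carrier n} → f ≋ g → ∏ f ≈ ∏ g
    ∏-cong = Prod.sum-cong-≋

    ∏-* : ∀ {n} (f g : Vector Carrier n) → ∏ (λ i → f i * g i) ≈ ∏ f * ∏ g
    ∏-* = Prod.∑-distrib-+

  ∏-scale : ∀ {n} a (f : Vector Carrier n) → ∏ (λ i → a * f i) ≈ a ^ n * ∏ f
  ∏-scale {zero}  a f = trans (∏-empty _) (sym (trans (*-identityˡ _) (∏-empty f)))
  ∏-scale {suc n} a f = begin
    ∏ (λ i → a * f i)                      ≈⟨ ∏-suc _ ⟩
    a * f zero * ∏ (λ i → a * f (suc i))   ≈⟨ *-congˡ (∏-scale a (f ∘ suc)) ⟩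
    a * f zero * (a ^ n * ∏ (f ∘ suc))     ≈⟨ solve 4 (λ a x p y → a :* x :* (p :* y) := a :* p :* (x :* y)) refl a (f zero) (a ^ n) (∏ (f ∘ suc)) ⟩
    a * a ^ n * (f zero * ∏ (f ∘ suc))     ≈⟨ *-congˡ (∏-suc f) ⟨
    a * a ^ n * ∏ f                        ∎

  Det-scale : ∀ {n} a (M : Matrix Carrier n) → Det (λ i j → a * M i j) ≈ a ^ n * Det M
  Det-scale {zero}  a M = trans (Det-empty _) (sym (trans (*-identityˡ _) (Det-empty M)))
  Det-scale {suc n} a M = begin
    Det (λ i j → a * M i j)
      ≈⟨ Det-suc _ ⟩
    ∑ (λ j → sign j * (a * M zero j) * Det (λ i l → a * M (suc i) (punchIn j l)))
      ≈⟨ ∑-cong (λ j → trans (*-congˡ (Det-scale a _)) (rearrange (sign j) a (M zero j) (a ^ n) _)) ⟩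
    ∑ (λ j → a * a ^ n * (sign j * M zero j * Det (λ i l → M (suc i) (punchIn j l))))
      ≈⟨ ∑-* _ _ ⟨
    a * a ^ n * ∑ (λ j → sign j * M zero j * Det (λ i l → M (suc i) (punchIn j l)))
      ≈⟨ *-congˡ (Det-suc M) ⟨
    a * a ^ n * Det M ∎
    where
    rearrange : ∀ s a m p d → s * (a * m) * (p * d) ≈ a * p * (s * m * d)
    rearrange = solve 5 (λ s a m p d → s :* (a :* m) :* (p :* d) := a :* p :* (s :* m :* d)) refl

  poly-∏ : ∀ {n} {f : Fin n → Carrier → Carrier} → (∀ i → IsPolynomial (f i)) →
           IsPolynomial (λ t → ∏ (λ i → f i t))
  poly-∏ {zero}  f-poly = poly-resp (λ t → ∏-empty _) (poly-const 1#)
  poly-∏ {suc n} f-poly = poly-resp (λ t → ∏-suc _) (poly-* (f-poly zero) (poly-∏ (f-poly ∘ suc)))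

  poly-affine : ∀ a b → IsPolynomial (λ t → a - t * b)
  poly-affine a b = poly-resp
    (λ t → solve 3 (λ a b t → a :- t :* b := a :+ t :* (:- b)) refl a b t)
    (poly-+ (poly-const a) (poly-t* (poly-const (- b))))

  trace : ∀ {n} → Matrix Carrier n → Carrier
  trace M = ∑ (λ i → M i i)

  -- f(t) = 1 - s t + O(t²)
  FirstOrder : (Carrier → Carrier) → Carrier → Set (c ⊔ˡ ℓ₁)
  FirstOrder f s = ∃[ g ] (IsPolynomial g × ∀ t → f t ≈ 1# - t * s + t * t * g t)

  -- Subtracting the two expansions and dividing by `t` gives `r + t * h t ≈ s + t * g t`, at first
  -- only for the positive nodes. Both sides are polynomial, so the identity holds at `t = 0` too.
  firstOrder-unique : ∀ {f r s} → FirstOrder f r → FirstOrder f s → r ≈ s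
  firstOrder-unique {f} {r} {s} (g , g-poly , f≈g) (h , h-poly , f≈h) = begin
    r               ≈⟨ solve 2 (λ r h → r := (r :+ con (+ 0) :* h)) refl r (h 0#) ⟩
    r + 0# * h 0#   ≈⟨ poly-ext (poly-+ (poly-const r) (poly-t* h-poly))
                         (poly-+ (poly-const s) (poly-t* g-poly)) agree 0# ⟩
    s + 0# * g 0#   ≈⟨ solve 2 (λ s g → s :+ con (+ 0) :* g := s) refl s (g 0#) ⟩
    s               ∎
    where
    agree : ∀ m → r + node m * h (node m) ≈ s + node m * g (node m)
    agree m = begin
      r + t * h t
        ≈⟨ solve 3 (λ r s x → r :+ x := (r :+ x :- s) :+ s) refl r s (t * h t) ⟩
      (r + t * h t - s) + s
        ≈⟨ solve 4 (λ d s a b → d :+ s := (d :- (a :- b)) :+ (a :- b) :+ s) refl (r + t * h t - s) s (t * g t) 0# ⟩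
      (r + t * h t - s - (t * g t - 0#)) + (t * g t - 0#) + s
        ≈⟨ +-congʳ (+-congʳ zero′) ⟩
      0# + (t * g t - 0#) + s
        ≈⟨ solve 2 (λ s a → con (+ 0) :+ (a :- con (+ 0)) :+ s := s :+ a) refl s (t * g t) ⟩
      s + t * g t ∎
      where
      t = node m
      zero′ : r + t * h t - s - (t * g t - 0#) ≈ 0#
      zero′ = x*y≈0⇒y≈0 (0<node m) (begin
        t * (r + t * h t - s - (t * g t - 0#))
          ≈⟨ solve 5 (λ t r s g h → t :* (r :+ t :* h :- s :- (t :* g :- con (+ 0))) :=
               (con (+ 1) :- t :* s :+ t :* t :* h) :- (con (+ 1) :- t :* r :+ t :* t :* g)) refl t r s (g t) (h t) ⟩
        (1# - t * s + t * t * h t) - (1# - t * r + t * t * g t)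
          ≈⟨ +-cong (sym (f≈h t)) (-‿cong (sym (f≈g t))) ⟩
        f t - f t
          ≈⟨ -‿inverseʳ _ ⟩
        0# ∎)

  firstOrder-* : ∀ {f a r} → FirstOrder f r → FirstOrder (λ t → (1# - t * a) * f t) (a + r)
  firstOrder-* {f} {a} {r} (g , g-poly , f≈g) =
    _ , poly-+ (poly-const (a * r)) (poly-* (poly-affine 1# a) g-poly) ,
    λ t → trans (*-congˡ (f≈g t))
      (solve 4 (λ t a r g → (con (+ 1) :- t :* a) :* (con (+ 1) :- t :* r :+ t :* t :* g) :=
        con (+ 1) :- t :* (a :+ r) :+ t :* t :* (a :* r :+ (con (+ 1) :- t :* a) :* g)) refl t a r (g t))

  firstOrder-resp : ∀ {f g r s} → (∀ t → f t ≈ g t) → r ≈ s → FirstOrder g s → FirstOrder f r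
  firstOrder-resp f≈g r≈s (h , h-poly , g≈h) =
    h , h-poly , λ t → trans (f≈g t) (trans (g≈h t) (+-congʳ (+-congˡ (-‿cong (*-congˡ (sym r≈s))))))

  firstOrder-1 : FirstOrder (λ _ → 1#) 0#
  firstOrder-1 = _ , poly-const 0# , λ t →
    solve 1 (λ t → con (+ 1) := con (+ 1) :- t :* con (+ 0) :+ t :* t :* con (+ 0)) refl t

  ∏-firstOrder : ∀ {n} (ν : Vector Carrier n) → FirstOrder (λ t → ∏ (λ i → 1# - t * ν i)) (∑ ν)
  ∏-firstOrder {zero}  ν = firstOrder-resp (λ t → ∏-empty _) (∑-empty ν) firstOrder-1
  ∏-firstOrder {suc n} ν = firstOrder-resp (λ t → ∏-suc _) (∑-suc ν) (firstOrder-* (∏-firstOrder (ν ∘ suc)))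

  -- Expansion along the first row either meets the divisible row at once or passes to minors that
  -- still contain it.
  Det-divisible-row : ∀ {n} (i : Fin n) {M : Carrier → Matrix Carrier n} {q : Fin n → Carrier → Carrier} →
    (∀ i j → IsPolynomial (λ t → M t i j)) → (∀ j → IsPolynomial (q j)) →
    (∀ t j → M t i j ≈ t * q j t) →
    ∃[ g ] (IsPolynomial g × ∀ t → Det (M t) ≈ t * g t)
  Det-divisible-row zero {M} {q} M-poly q-poly M≈tq =
    _ , poly-∑ (λ j → poly-* (poly-scale (sign j) (q-poly j))
                             (poly-Det λ i l → M-poly (suc i) (punchIn j l))) ,
    λ t → trans (Det-suc _) (trans
      (∑-cong λ j → trans (*-congʳ (*-congˡ (M≈tq t j))) (rearrange (sign j) t (q j t) _))
      (sym (∑-* t _)))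
    where
    rearrange : ∀ s t q d → s * (t * q) * d ≈ t * (s * q * d)
    rearrange = solve 4 (λ s t q d → s :* (t :* q) :* d := t :* (s :* q :* d)) refl
  Det-divisible-row (suc i) {M} {q} M-poly q-poly M≈tq =
    _ , poly-∑ (λ j → poly-* (poly-scale (sign j) (M-poly zero j)) (proj₁ (proj₂ (minor j)))) ,
    λ t → trans (Det-suc _) (trans
      (∑-cong λ j → trans (*-congˡ (proj₂ (proj₂ (minor j)) t)) (rearrange (sign j * M t zero j) t _))
      (sym (∑-* t _)))
    where
    minor : ∀ j → ∃[ g ] (IsPolynomial g × ∀ t → Det (λ i l → M t (suc i) (punchIn j l)) ≈ t * g t)
    minor j = Det-divisible-row i (λ i l → M-poly (suc i) (punchIn j l)) (λ l → q-poly (punchIn j l))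
      (λ t l → M≈tq t (punchIn j l))
    rearrange : ∀ a t d → a * (t * d) ≈ t * (a * d)
    rearrange = solve 3 (λ a t d → a :* (t :* d) := t :* (a :* d)) refl

  δ-punchIn : ∀ {n} (j : Fin (suc n)) l → δ j (punchIn j l) ≈ 0#
  δ-punchIn zero    l       = refl
  δ-punchIn (suc j) zero    = refl
  δ-punchIn (suc j) (suc l) = δ-punchIn j l

  1-_·_ : ∀ {n} → Carrier → Matrix Carrier n → Matrix Carrier n
  (1- t · M) i j = δ i j - t * M i j

  -- In the expansion along row `zero`, the diagonal entry yields the same problem one size smaller.
  -- Any other entry, in column `suc j`, is a multiple of `t`. Its minor keeps row `suc j` but loses
  -- that row's diagonal entry, so it is divisible by `t` as well, and the term is O(t²).
  Det-firstOrder : ∀ {n} (M : Matrix Carrier n) → FirstOrder (λ t → Det (1- t · M)) (trace M)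
  Det-firstOrder {zero}  M = firstOrder-resp (λ t → Det-empty _) (∑-empty _) firstOrder-1
  Det-firstOrder {suc n} M =
    (λ t → g t + h t) , poly-+ g-poly h-poly , λ t → begin
    Det (1- t · M)
      ≈⟨ trans (Det-suc _) (∑-suc _) ⟩
    1# * (1# - t * M zero zero) * Det (1- t · M′)
      + ∑ (λ j → sign (suc j) * (0# - t * M zero (suc j)) * Det (minor j t))
      ≈⟨ +-cong (trans (*-congʳ (*-identityˡ _)) (first t)) (trans
           (∑-cong λ j → trans (*-congˡ (minor≈ j t))
             (rearrange (sign (suc j)) t (M zero (suc j)) (q j t)))
           (sym (∑-* (t * t) (λ j → sign (suc j) * - M zero (suc j) * q j t)))) ⟩
    1# - t * (M zero zero + trace M′) + t * t * g t + t * t * h t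
      ≈⟨ trans (+-assoc _ _ _) (+-congˡ (sym (distribˡ _ _ _))) ⟩
    1# - t * (M zero zero + trace M′) + t * t * (g t + h t)
      ≈⟨ +-congʳ (+-congˡ (-‿cong (*-congˡ (∑-suc (λ i → M i i))))) ⟨
    1# - t * trace M + t * t * (g t + h t) ∎
    where
    M′ : Matrix Carrier n
    M′ i j = M (suc i) (suc j)
    minor : Fin n → Carrier → Matrix Carrier n
    minor j t i l = (1- t · M) (suc i) (punchIn (suc j) l)
    first-order : FirstOrder (λ t → (1# - t * M zero zero) * Det (1- t · M′)) (M zero zero + trace M′)
    first-order = firstOrder-* (Det-firstOrder M′)
    divisible : ∀ j → ∃[ q ] (IsPolynomial q × ∀ t → Det (minor j t) ≈ t * q t)
    divisible j = Det-divisible-row j {q = λ l t → - M (suc j) (punchIn (suc j) l)}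
      (λ i l → poly-affine _ _) (λ l → poly-const _)
      (λ t l → trans (+-congʳ (δ-punchIn (suc j) l))
        (solve 2 (λ t m → con (+ 0) :- t :* m := t :* :- m) refl t (M (suc j) (punchIn (suc j) l))))
    g : Carrier → Carrier
    g = proj₁ first-order
    g-poly : IsPolynomial g
    g-poly = proj₁ (proj₂ first-order)
    first : ∀ t → (1# - t * M zero zero) * Det (1- t · M′) ≈ 1# - t * (M zero zero + trace M′) + t * t * g t
    first = proj₂ (proj₂ first-order)
    q : Fin n → Carrier → Carrier
    q j = proj₁ (divisible j)
    minor≈ : ∀ j t → Det (minor j t) ≈ t * q j t
    minor≈ j = proj₂ (proj₂ (divisible j))
    h : Carrier → Carrier
    h t = ∑ (λ j → sign (suc j) * - M zero (suc j) * q j t)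
    h-poly : IsPolynomial h
    h-poly = poly-∑ λ j → poly-scale (sign (suc j) * - M zero (suc j)) (proj₁ (proj₂ (divisible j)))
    rearrange : ∀ s t m d → s * (0# - t * m) * (t * d) ≈ t * t * (s * - m * d)
    rearrange = solve 4 (λ s t m d → s :* (con (+ 0) :- t :* m) :* (t :* d) := t :* t :* (s :* :- m :* d)) refl

  -- The reversed characteristic polynomial of M has the roots 1/νᵢ.
  Splits : ∀ {n} → Matrix Carrier n → Vector Carrier n → Set (c ⊔ˡ ℓ₁)
  Splits M ν = ∀ t → Det (1- t · M) ≈ ∏ (λ i → 1# - t * ν i)

  splits-trace : ∀ {n} {M : Matrix Carrier n} {ν} → Splits M ν → trace M ≈ ∑ ν
  splits-trace {M = M} {ν} M-splits = firstOrder-unique (Det-firstOrder M)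
    (firstOrder-resp M-splits refl (∏-firstOrder ν))

  splits-from-nodes : ∀ {n} {M : Matrix Carrier n} {ν} →
    (∀ m → Det (1- node m · M) ≈ ∏ (λ i → 1# - node m * ν i)) → Splits M ν
  splits-from-nodes = poly-ext (poly-Det λ i j → poly-affine _ _) (poly-∏ λ i → poly-affine _ _)

  δ-sym : ∀ {n} (i j : Fin n) → δ i j ≈ δ j i
  δ-sym zero    zero    = refl
  δ-sym zero    (suc j) = refl
  δ-sym (suc i) zero    = refl
  δ-sym (suc i) (suc j) = δ-sym i j

  -- Graeffe: 1 - s²M² = (1 - sM)(1 + sM)
  splits-square : ∀ {n} {M : Matrix Carrier n} {ν} → Splits M ν → Splits (M ⊡ M) (λ i → ν i * ν i)
  -- At a node t = s² with `s` known, the factorisation of `M` can be applied at both `s` and `- s`.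
  -- Neither need be a node, which is why `Splits` quantifies over all `t`.
  splits-square {M = M} {ν} M-splits = splits-from-nodes λ m → let s = ι (suc m) in begin
    Det (1- s * s · (M ⊡ M))
      ≈⟨ Det-cong (factor s) ⟩
    Det ((1- s · M) ⊡ (1- - s · M))
      ≈⟨ Det-⊡ _ _ ⟩
    Det (1- s · M) * Det (1- - s · M)
      ≈⟨ *-cong (M-splits s) (M-splits (- s)) ⟩
    ∏ (λ i → 1# - s * ν i) * ∏ (λ i → 1# - - s * ν i)
      ≈⟨ ∏-* _ _ ⟨
    ∏ (λ i → (1# - s * ν i) * (1# - - s * ν i))
      ≈⟨ ∏-cong (λ i → solve 2 (λ s v → (con (+ 1) :- s :* v) :* (con (+ 1) :- :- s :* v) :=
           con (+ 1) :- s :* s :* (v :* v)) refl s (ν i)) ⟩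
    ∏ (λ i → 1# - s * s * (ν i * ν i)) ∎
    where
    factor : ∀ s i j → (1- s * s · (M ⊡ M)) i j ≈ ((1- s · M) ⊡ (1- - s · M)) i j
    factor s i j = sym (begin
      ∑ (λ l → (δ i l - s * M i l) * (δ l j - - s * M l j))
        ≈⟨ ∑-cong (λ l → trans (expand (δ i l) (δ l j) s (M i l) (M l j)) (+-congʳ (+-congˡ (*-congʳ (δ-sym l j))))) ⟩
      ∑ (λ l → δ i l * (δ l j + s * M l j) + δ j l * (- s * M i l) + - (s * s) * (M i l * M l j))
        ≈⟨ trans (∑-+ _ _) (+-cong (∑-+ _ _) (sym (∑-* _ _))) ⟩
      ∑ (λ l → δ i l * (δ l j + s * M l j)) + ∑ (λ l → δ j l * (- s * M i l)) + - (s * s) * (M ⊡ M) i j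
        ≈⟨ +-congʳ (+-cong (δ-sum i _) (δ-sum j _)) ⟩
      δ i j + s * M i j + - s * M i j + - (s * s) * (M ⊡ M) i j
        ≈⟨ solve 4 (λ d s m k → d :+ s :* m :+ :- s :* m :+ :- (s :* s) :* k := d :- s :* s :* k)
             refl (δ i j) s (M i j) ((M ⊡ M) i j) ⟩
      δ i j - s * s * (M ⊡ M) i j ∎)
      where
      expand : ∀ d e s a b → (d - s * a) * (e - - s * b) ≈ d * (e + s * b) + e * (- s * a) + - (s * s) * (a * b)
      expand = solve 5 (λ d e s a b → (d :- s :* a) :* (e :- :- s :* b) :=
        d :* (e :+ s :* b) :+ e :* (:- s :* a) :+ :- (s :* s) :* (a :* b)) refl

  -- From det (1 - tM) = tⁿ det (t⁻¹ - M). The inverse needs `t` apart from 0, which the nodes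
  -- satisfy; the other `t`, including 0, follow by interpolation.
  spectrum⇒splits : ∀ {n} {M : Matrix Carrier n} {μ} → IsSpectrum ℝ M μ → Splits M μ
  spectrum⇒splits {n} {M} {μ} spec = splits-from-nodes λ m → let
      t = node m
      t#0 = #-sym (<⇒# (0<node m))
      x = 1# / t ⟨ t#0 ⟩
      tx≈1 : t * x ≈ 1#
      tx≈1 = trans (*-comm t x) (/-*-cancel 1# t#0)
    in begin
    Det (1- t · M)
      ≈⟨ Det-cong (λ i j → entry t x tx≈1 (does (i ≟ j)) (M i j)) ⟩
    Det (λ i j → t * ((if does (i ≟ j) then x else 0#) - M i j))
      ≈⟨ Det-scale t _ ⟩
    t ^ n * Det (λ i j → (if does (i ≟ j) then x else 0#) - M i j)
      ≡⟨ ≡.cong (t ^ n *_) (Det≡det _) ⟩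
    t ^ n * charPoly ℝ M x
      ≈⟨ *-congˡ (IsSpectrum.charPoly-splits spec x) ⟩
    t ^ n * product (λ i → x - μ i)
      ≡⟨ ≡.cong (t ^ n *_) (∏≡product _) ⟨
    t ^ n * ∏ (λ i → x - μ i)
      ≈⟨ ∏-scale t _ ⟨
    ∏ (λ i → t * (x - μ i))
      ≈⟨ ∏-cong (λ i → trans (x[y-z]≈xy-xz t x (μ i)) (+-congʳ tx≈1)) ⟩
    ∏ (λ i → 1# - t * μ i) ∎
    where
    entry : ∀ t x → t * x ≈ 1# → ∀ (b : Bool) a →
            (if b then 1# else 0#) - t * a ≈ t * ((if b then x else 0#) - a)
    entry t x tx≈1 true  a = sym (trans (x[y-z]≈xy-xz t x a) (+-congʳ tx≈1))
    entry t x tx≈1 false a = sym (trans (x[y-z]≈xy-xz t 0# a) (+-congʳ (zeroʳ t)))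

-- Norm bounds on the complement of the constants

module Rayleigh {c ℓ₁ ℓ₂} (ℝ : RealNumbers c ℓ₁ ℓ₂) where
  open RealNumbers ℝ
  open IntegerCoefficients commutativeRing
  open Determinants ℝ
  open Order ℝ
  open Polynomials ℝ
  open ≤-Reasoning

  -- The power x^(2^r).
  sq : ℕ → Carrier → Carrier
  sq zero    x = x
  sq (suc r) x = sq r x * sq r x

  sq-cong : ∀ r {x y} → x ≈ y → sq r x ≈ sq r y
  sq-cong zero    x≈y = x≈y
  sq-cong (suc r) x≈y = *-cong (sq-cong r x≈y) (sq-cong r x≈y)

  sq-* : ∀ r x y → sq r (x * y) ≈ sq r x * sq r y
  sq-* zero    x y = refl
  sq-* (suc r) x y = trans (*-cong (sq-* r x y) (sq-* r x y))
    (solve 2 (λ a b → a :* b :* (a :* b) := a :* a :* (b :* b)) refl (sq r x) (sq r y))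

  0<sq : ∀ r {x} → 0# < x → 0# < sq r x
  0<sq zero    0<x = 0<x
  0<sq (suc r) 0<x = *-pos (0<sq r 0<x) (0<sq r 0<x)

  -- The hypothesis compares squares so that `x` and `y` may have either sign; after one squaring
  -- all quantities are nonnegative.
  sq-mono : ∀ r {x y} → x * x ≤ y * y → sq (suc r) x ≤ sq (suc r) y
  sq-mono zero    xx≤yy = xx≤yy
  sq-mono (suc r) xx≤yy = *-mono-≤ (0≤x*x _) (0≤x*x _) (sq-mono r xx≤yy) (sq-mono r xx≤yy)

  -- Bernoulli's inequality (1 + ε/y)^(2^r) ≥ 1 + (r + 1)ε/y with denominators cleared. The
  -- coefficient r + 1 is far from sharp, but it is unbounded and survives squaring.
  sq-growth : ∀ r {y ε} → 0# < y → 0# < ε → sq r y * (y + ι (suc r) * ε) ≤ y * sq r (y + ε)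
  sq-growth zero {y} {ε} 0<y 0<ε =
    ≤-reflexive (*-congˡ (+-congˡ (trans (*-congʳ (+-identityʳ 1#)) (*-identityˡ ε))))
  sq-growth (suc r) {y} {ε} 0<y 0<ε = *-cancelˡ-≤ 0<y (begin
    y * (Y * Y * (y + ι (suc (suc r)) * ε))
      ≈⟨ +-identityʳ _ ⟨
    y * (Y * Y * (y + ι (suc (suc r)) * ε)) + 0#
      -- The added term is the slack in squaring: `Y * Y` times (y + kε)² - y(y + (k + 1)ε), where k
      -- = r + 1.
      ≤⟨ +-mono-≤ (≤-reflexive refl) (0≤* (0≤x*x Y) (0≤+ (0≤x*x ((1# + κ) * ε)) (0≤* (0≤* (0≤ι r) (<⇒≤ 0<ε)) (<⇒≤ 0<y)))) ⟩
    y * (Y * Y * (y + ι (suc (suc r)) * ε)) + Y * Y * ((1# + κ) * ε * ((1# + κ) * ε) + κ * ε * y)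
      ≈⟨ solve 4 (λ y Y κ ε →
           let k = con (+ 1) :+ κ in
           y :* (Y :* Y :* (y :+ (con (+ 1) :+ k) :* ε)) :+ Y :* Y :* (k :* ε :* (k :* ε) :+ κ :* ε :* y)
           := Y :* (y :+ k :* ε) :* (Y :* (y :+ k :* ε))) refl y Y κ ε ⟩
    Y * (y + ι (suc r) * ε) * (Y * (y + ι (suc r) * ε))
      ≤⟨ *-mono-≤ 0≤lhs 0≤lhs (sq-growth r 0<y 0<ε) (sq-growth r 0<y 0<ε) ⟩
    y * X * (y * X)
      ≈⟨ solve 2 (λ y X → y :* X :* (y :* X) := y :* (y :* (X :* X))) refl y X ⟩
    y * (y * (X * X)) ∎)
    where
    κ = ι r
    Y = sq r y
    X = sq r (y + ε)
    0≤lhs : 0# ≤ Y * (y + ι (suc r) * ε)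
    0≤lhs = 0≤* (<⇒≤ (0<sq r 0<y)) (0≤+ (<⇒≤ 0<y) (0≤* (0≤ι (suc r)) (<⇒≤ 0<ε)))

  -- x ≤ K^(1/N) y for N = 2, 4, 8, …
  power-trick : ∀ {x y} K → 0# ≤ y → (∀ r → sq (suc r) x ≤ K * sq (suc r) y) → x ≤ y
  power-trick {x} {y} K 0≤y bound = 0≤-cases 0≤y zero-case pos-case
    where
    zero-case : y ≈ 0# → x ≤ y
    zero-case y≈0 y<x = bound 0 (begin-strict
      K * (y * y)  ≈⟨ trans (*-congˡ (trans (*-congʳ y≈0) (zeroˡ y))) (zeroʳ K) ⟩
      0#           <⟨ *-pos 0<x 0<x ⟩
      x * x        ∎)
      where
      0<x : 0# < x
      0<x = ≤-<-trans 0≤y y<x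
    -- If `x` exceeded `y` by `ε`, the growth estimate would give y + (r + 2)ε ≤ yK for every r,
    -- against the Archimedean property.
    pos-case : 0# < y → x ≤ y
    pos-case 0<y y<x = too-small (begin-strict
      y * K                        ≈⟨ /-*-cancel (y * K) ε#0 ⟨
      y * K / ε ⟨ ε#0 ⟩ * ε         ≈⟨ *-comm _ _ ⟩
      ε * (y * K / ε ⟨ ε#0 ⟩)       <⟨ *-monoʳ-< 0<ε (proj₂ large) ⟩
      ε * ι N                      ≈⟨ *-comm _ _ ⟩
      ι N * ε                      ≈⟨ +-identityˡ _ ⟨
      0# + ι N * ε                 ≤⟨ +-mono-≤ 0≤y (*-mono-≤ (0≤ι N) (<⇒≤ 0<ε) (ι-mono-≤ {N} {suc (suc N)} (ℕₚ.m≤n+m N 2)) (≤-reflexive refl)) ⟩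
      y + ι (suc (suc N)) * ε      ∎)
      where
      ε = x - y
      0<ε : 0# < ε
      0<ε = x<y⇒0<y-x y<x
      ε#0 : ε # 0#
      ε#0 = #-sym (<⇒# 0<ε)
      large = archimedean (y * K / ε ⟨ ε#0 ⟩)
      N = proj₁ large
      y+ε≈x : y + ε ≈ x
      y+ε≈x = solve 2 (λ x y → y :+ (x :- y) := x) refl x y
      -- The bound at `N` concerns `sq (suc N)`, for which `sq-growth` has the coefficient N + 2.
      too-small : y + ι (suc (suc N)) * ε ≤ y * K
      too-small = *-cancelˡ-≤ (0<sq (suc N) 0<y) (begin
        sq (suc N) y * (y + ι (suc (suc N)) * ε)  ≤⟨ sq-growth (suc N) 0<y 0<ε ⟩
        y * sq (suc N) (y + ε)                    ≈⟨ *-congˡ (sq-cong (suc N) y+ε≈x) ⟩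
        y * sq (suc N) x                          ≤⟨ *-monoʳ-≤ 0≤y (bound N) ⟩
        y * (K * sq (suc N) y)                    ≈⟨ solve 3 (λ y K s → y :* (K :* s) := s :* (y :* K)) refl y K (sq (suc N) y) ⟩
        sq (suc N) y * (y * K)                    ∎)

  infixr 7 _⊛_
  _⊛_ : ∀ {n} → Matrix Carrier n → Vector Carrier n → Vector Carrier n
  (M ⊛ v) i = M i ∙ v

  Symmetric : ∀ {n} → Matrix Carrier n → Set ℓ₁
  Symmetric M = ∀ i j → M i j ≈ M j i

  RowSum : ∀ {n} → Matrix Carrier n → Carrier → Set ℓ₁
  RowSum M D = ∀ i → ∑ (M i) ≈ D

  ∙-cong : ∀ {n} {u u′ v v′ : Vector Carrier n} → u ≋ u′ → v ≋ v′ → u ∙ v ≈ u′ ∙ v′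
  ∙-cong u≋u′ v≋v′ = ∑-cong λ i → *-cong (u≋u′ i) (v≋v′ i)

  ⊡-⊛ : ∀ {n} (M N : Matrix Carrier n) v → (M ⊡ N) ⊛ v ≋ M ⊛ N ⊛ v
  ⊡-⊛ M N v i = begin-equality
    ∑ (λ j → ∑ (λ l → M i l * N l j) * v j)     ≈⟨ ∑-cong (λ j → ∑-*ʳ (v j) _) ⟩
    ∑ (λ j → ∑ (λ l → M i l * N l j * v j))     ≈⟨ ∑-comm _ ⟩
    ∑ (λ l → ∑ (λ j → M i l * N l j * v j))     ≈⟨ ∑-cong (λ l → trans (∑-cong λ j → *-assoc _ _ _) (sym (∑-* (M i l) _))) ⟩
    ∑ (λ l → M i l * ∑ (λ j → N l j * v j))     ∎

  self-adjoint : ∀ {n} {M : Matrix Carrier n} → Symmetric M → ∀ u v → u ∙ (M ⊛ v) ≈ (M ⊛ u) ∙ v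
  self-adjoint {M = M} M-sym u v = begin-equality
    ∑ (λ i → u i * ∑ (λ j → M i j * v j))       ≈⟨ ∑-cong (λ i → ∑-* (u i) _) ⟩
    ∑ (λ i → ∑ (λ j → u i * (M i j * v j)))     ≈⟨ ∑-comm _ ⟩
    ∑ (λ j → ∑ (λ i → u i * (M i j * v j)))     ≈⟨ ∑-cong (λ j → trans (∑-cong λ i → swap (u i) (M i j) (v j) (M j i) (M-sym i j)) (sym (∑-*ʳ (v j) _))) ⟩
    ∑ (λ j → ∑ (λ i → M j i * u i) * v j)       ∎
    where
    swap : ∀ a m b m′ → m ≈ m′ → a * (m * b) ≈ m′ * a * b
    swap a m b m′ m≈m′ = trans (solve 3 (λ a m b → a :* (m :* b) := m :* a :* b) refl a m b) (*-congʳ (*-congʳ m≈m′))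

  ⊡-symmetric : ∀ {n} {M : Matrix Carrier n} → Symmetric M → Symmetric (M ⊡ M)
  ⊡-symmetric M-sym i j = ∑-cong λ l → trans (*-cong (M-sym i l) (M-sym l j)) (*-comm _ _)

  ⊡-rowSum : ∀ {n} {M : Matrix Carrier n} {D} → RowSum M D → RowSum (M ⊡ M) (D * D)
  ⊡-rowSum {M = M} {D} M-row i = begin-equality
    ∑ (λ j → ∑ (λ l → M i l * M l j))   ≈⟨ ∑-comm _ ⟩
    ∑ (λ l → ∑ (λ j → M i l * M l j))   ≈⟨ ∑-cong (λ l → trans (sym (∑-* (M i l) _)) (*-congˡ (M-row l))) ⟩
    ∑ (λ l → M i l * D)                 ≈⟨ ∑-*ʳ D _ ⟨
    ∑ (M i) * D                         ≈⟨ *-congʳ (M-row i) ⟩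
    D * D                               ∎

  ∑-const : ∀ n a → ∑ {n} (λ _ → a) ≈ ι n * a
  ∑-const zero    a = trans (∑-empty _) (sym (zeroˡ a))
  ∑-const (suc n) a = begin-equality
    ∑ (λ _ → a)           ≈⟨ ∑-suc _ ⟩
    a + ∑ {n} (λ _ → a)   ≈⟨ +-cong (sym (*-identityˡ a)) (∑-const n a) ⟩
    1# * a + ι n * a      ≈⟨ distribʳ a 1# (ι n) ⟨
    ι (suc n) * a         ∎

  -- Cauchy–Schwarz against the rows of nM - DJ, which annihilates the
  -- constants; J is the all-ones matrix.
  frobenius : ∀ {n} {M : Matrix Carrier (suc n)} {D} → Symmetric M → RowSum M D →
    ∀ {v} → ∑ v ≈ 0# → (M ⊛ v) ∙ (M ⊛ v) ≤ v ∙ v * (trace (M ⊡ M) - D * D)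
  frobenius {n} {M} {D} M-sym M-row {v} ∑v≈0 = *-cancelˡ-≤ (*-pos (0<ι n) (0<ι n)) (begin
    N * N * (M ⊛ v) ∙ (M ⊛ v)
      ≈⟨ trans (∑-* _ _) (∑-cong λ i → solve 2 (λ N x → N :* N :* (x :* x) := N :* x :* (N :* x)) refl N (M i ∙ v)) ⟩
    ∑ (λ i → N * M i ∙ v * (N * M i ∙ v))
      ≈⟨ ∑-cong (λ i → *-cong (r∙v i) (r∙v i)) ⟨
    ∑ (λ i → r i ∙ v * r i ∙ v)
      ≤⟨ ∑-mono-≤ (λ i → cauchy-schwarz (r i) v) ⟩
    ∑ (λ i → r i ∙ r i * v ∙ v)
      ≈⟨ ∑-*ʳ (v ∙ v) _ ⟨
    ∑ (λ i → r i ∙ r i) * v ∙ v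
      -- The squared Frobenius norm of nM - DJ is n²(tr M² - D²).
      ≈⟨ *-congʳ (trans (∑-cong r∙r) (trans (∑-+ _ _) (+-cong (sym (∑-* _ _)) (∑-const (suc n) _)))) ⟩
    (N * N * trace (M ⊡ M) + N * - (N * (D * D))) * v ∙ v
      ≈⟨ solve 4 (λ N t D a → (N :* N :* t :+ N :* :- (N :* D)) :* a := N :* N :* (a :* (t :- D))) refl N (trace (M ⊡ M)) (D * D) (v ∙ v) ⟩
    N * N * (v ∙ v * (trace (M ⊡ M) - D * D)) ∎)
    where
    N = ι (suc n)
    r : Matrix Carrier (suc n)
    r i j = N * M i j + - D
    r∙v : ∀ i → r i ∙ v ≈ N * M i ∙ v
    r∙v i = begin-equality
      ∑ (λ j → (N * M i j + - D) * v j)            ≈⟨ ∑-cong (λ j → trans (distribʳ _ _ _) (+-congʳ (*-assoc _ _ _))) ⟩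
      ∑ (λ j → N * (M i j * v j) + - D * v j)      ≈⟨ trans (∑-+ _ _) (+-cong (sym (∑-* N _)) (sym (∑-* (- D) v))) ⟩
      N * M i ∙ v + - D * ∑ v                      ≈⟨ trans (+-congˡ (trans (*-congˡ ∑v≈0) (zeroʳ _))) (+-identityʳ _) ⟩
      N * M i ∙ v                                  ∎
    expand : ∀ N m m′ D → m ≈ m′ → (N * m + - D) * (N * m + - D) ≈ N * N * (m * m′) + - (ι 2 * N * D) * m + D * D
    expand N m m′ D m≈m′ = trans
      (solve 3 (λ N m D → (N :* m :+ :- D) :* (N :* m :+ :- D) :=
        N :* N :* (m :* m) :+ :- ((con (+ 1) :+ (con (+ 1) :+ con (+ 0))) :* N :* D) :* m :+ D :* D) refl N m D)
      (+-congʳ (+-congʳ (*-congˡ (*-congˡ m≈m′))))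
    r∙r : ∀ i → r i ∙ r i ≈ N * N * (M ⊡ M) i i + - (N * (D * D))
    r∙r i = begin-equality
      ∑ (λ j → (N * M i j + - D) * (N * M i j + - D))
        ≈⟨ ∑-cong (λ j → expand N (M i j) (M j i) D (M-sym i j)) ⟩
      ∑ (λ j → N * N * (M i j * M j i) + - (ι 2 * N * D) * M i j + D * D)
        ≈⟨ trans (∑-+ _ _) (+-cong (trans (∑-+ _ _) (+-cong (sym (∑-* _ _)) (sym (∑-* _ _)))) (∑-const (suc n) _)) ⟩
      N * N * (M ⊡ M) i i + - (ι 2 * N * D) * ∑ (M i) + N * (D * D)
        ≈⟨ +-congʳ (+-congˡ (*-congˡ (M-row i))) ⟩
      N * N * (M ⊡ M) i i + - (ι 2 * N * D) * D + N * (D * D)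
        ≈⟨ solve 3 (λ N m D → N :* N :* m :+ :- ((con (+ 1) :+ (con (+ 1) :+ con (+ 0))) :* N :* D) :* D :+ N :* (D :* D)
             := N :* N :* m :+ :- (N :* (D :* D))) refl N ((M ⊡ M) i i) D ⟩
      N * N * (M ⊡ M) i i + - (N * (D * D)) ∎

  -- Cauchy-Schwarz for `v` and `M ⊛ v`. For a unit vector it says that squaring the matrix at least
  -- squares the Rayleigh quotient, which is what gets iterated.
  rayleigh-square : ∀ {n} {M : Matrix Carrier n} → Symmetric M → ∀ v →
    v ∙ (M ⊛ v) * v ∙ (M ⊛ v) ≤ v ∙ v * v ∙ ((M ⊡ M) ⊛ v)
  rayleigh-square {M = M} M-sym v = begin
    v ∙ (M ⊛ v) * v ∙ (M ⊛ v)     ≤⟨ cauchy-schwarz v (M ⊛ v) ⟩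
    v ∙ v * (M ⊛ v) ∙ (M ⊛ v)     ≈⟨ *-congˡ (self-adjoint M-sym v (M ⊛ v)) ⟨
    v ∙ v * v ∙ (M ⊛ M ⊛ v)       ≈⟨ *-congˡ (∙-cong (λ _ → refl) (⊡-⊛ M M v)) ⟨
    v ∙ v * v ∙ ((M ⊡ M) ⊛ v)     ∎

  msq : ∀ {n} → ℕ → Matrix Carrier n → Matrix Carrier n
  msq zero    M = M
  msq (suc r) M = msq r M ⊡ msq r M

  msq-symmetric : ∀ {n} r {M : Matrix Carrier n} → Symmetric M → Symmetric (msq r M)
  msq-symmetric zero    M-sym = M-sym
  msq-symmetric (suc r) M-sym = ⊡-symmetric (msq-symmetric r M-sym)

  msq-rowSum : ∀ {n} r {M : Matrix Carrier n} {D} → RowSum M D → RowSum (msq r M) (sq r D)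
  msq-rowSum zero    M-row = M-row
  msq-rowSum (suc r) M-row = ⊡-rowSum (msq-rowSum r M-row)

  msq-splits : ∀ {n} r {M : Matrix Carrier n} {ν} → Splits M ν → Splits (msq r M) (λ i → sq r (ν i))
  msq-splits zero    M-splits = M-splits
  msq-splits (suc r) M-splits = splits-square (msq-splits r M-splits)

  -- The form at M^(2^(r+1)) is squeezed: `lower` iterates `rayleigh-square`, while `upper` combines
  -- `frobenius` with the trace. The two differ by the factor `ι m`, the number of eigenvalues other
  -- than `ν zero`, which is independent of r as `power-trick` requires. Powers of `a = v ∙ v` stand
  -- in for normalising `v`, which might be 0.
  rayleigh : ∀ {m} {M : Matrix Carrier (suc m)} {D L} {ν : Vector Carrier (suc m)} →
    Symmetric M → RowSum M D → Splits M ν → ν zero ≈ D →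
    0# ≤ L → (∀ i → ν (suc i) * ν (suc i) ≤ L * L) →
    ∀ {v} → ∑ v ≈ 0# → v ∙ (M ⊛ v) ≤ v ∙ v * L
  rayleigh {m} {M} {D} {L} {ν} M-sym M-row M-splits ν₀≈D 0≤L ν≤L {v} ∑v≈0 =
    power-trick (ι m) (0≤* 0≤a 0≤L) λ r → begin
      sq (suc r) x
        ≤⟨ lower r ⟩
      e (suc r) * b (suc r)
        ≤⟨ *-monoʳ-≤ (0≤e (suc r)) (upper r) ⟩
      e (suc r) * (a * (ι m * sq (suc r) L))
        ≈⟨ *-assoc _ _ _ ⟨
      e (suc r) * a * (ι m * sq (suc r) L)
        ≈⟨ *-congʳ (e*a (suc r)) ⟩
      sq (suc r) a * (ι m * sq (suc r) L)
        ≈⟨ solve 3 (λ a m l → a :* (m :* l) := m :* (a :* l)) refl (sq (suc r) a) (ι m) (sq (suc r) L) ⟩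
      ι m * (sq (suc r) a * sq (suc r) L)
        ≈⟨ *-congˡ (sq-* (suc r) a L) ⟨
      ι m * sq (suc r) (a * L) ∎
    where
    a = v ∙ v
    x = v ∙ (M ⊛ v)
    0≤a : 0# ≤ a
    0≤a = 0≤v∙v v
    b : ℕ → Carrier
    b r = v ∙ (msq r M ⊛ v)
    -- a^(2^r - 1)
    e : ℕ → Carrier
    e zero    = 1#
    e (suc r) = e r * e r * a
    0≤e : ∀ r → 0# ≤ e r
    0≤e zero    = <⇒≤ 0<1
    0≤e (suc r) = 0≤* (0≤x*x (e r)) 0≤a
    e*a : ∀ r → e r * a ≈ sq r a
    e*a zero    = *-identityˡ a
    e*a (suc r) = trans (solve 2 (λ e a → e :* e :* a :* a := e :* a :* (e :* a)) refl (e r) a) (*-cong (e*a r) (e*a r))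
    b-square : ∀ r → b r * b r ≤ a * b (suc r)
    b-square r = rayleigh-square (msq-symmetric r M-sym) v
    lower : ∀ r → sq (suc r) x ≤ e (suc r) * b (suc r)
    lower zero = begin
      x * x                  ≤⟨ b-square 0 ⟩
      a * b 1                ≈⟨ *-congʳ (trans (*-congʳ (*-identityˡ 1#)) (*-identityˡ a)) ⟨
      1# * 1# * a * b 1      ∎
    lower (suc r) = begin
      sq (suc r) x * sq (suc r) x
        ≤⟨ *-mono-≤ (0≤x*x _) (0≤x*x _) (lower r) (lower r) ⟩
      e (suc r) * b (suc r) * (e (suc r) * b (suc r))
        ≈⟨ solve 2 (λ e b → e :* b :* (e :* b) := e :* e :* (b :* b)) refl (e (suc r)) (b (suc r)) ⟩
      e (suc r) * e (suc r) * (b (suc r) * b (suc r))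
        ≤⟨ *-monoʳ-≤ (0≤x*x _) (b-square (suc r)) ⟩
      e (suc r) * e (suc r) * (a * b (suc (suc r)))
        ≈⟨ *-assoc _ _ _ ⟨
      e (suc (suc r)) * b (suc (suc r)) ∎
    upper : ∀ r → b (suc r) ≤ a * (ι m * sq (suc r) L)
    upper r = begin
      v ∙ ((P ⊡ P) ⊛ v)
        ≈⟨ trans (∙-cong (λ _ → refl) (⊡-⊛ P P v)) (self-adjoint (msq-symmetric r M-sym) v (P ⊛ v)) ⟩
      (P ⊛ v) ∙ (P ⊛ v)
        ≤⟨ frobenius (msq-symmetric r M-sym) (msq-rowSum r M-row) ∑v≈0 ⟩
      a * (trace (P ⊡ P) - sq (suc r) D)
        ≈⟨ *-congˡ (+-congʳ (trans (splits-trace (msq-splits (suc r) M-splits)) (∑-suc _))) ⟩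
      a * (sq (suc r) (ν zero) + ∑ (λ i → sq (suc r) (ν (suc i))) - sq (suc r) D)
        -- The eigenvalue belonging to the constants contributes exactly what `frobenius` subtracts.
        ≈⟨ *-congˡ (+-congʳ (+-congʳ (sq-cong (suc r) ν₀≈D))) ⟩
      a * (sq (suc r) D + ∑ (λ i → sq (suc r) (ν (suc i))) - sq (suc r) D)
        ≈⟨ *-congˡ (solve 2 (λ d s → d :+ s :- d := s) refl (sq (suc r) D) (∑ (λ i → sq (suc r) (ν (suc i))))) ⟩
      a * ∑ (λ i → sq (suc r) (ν (suc i)))
        ≤⟨ *-monoʳ-≤ 0≤a (∑-mono-≤ λ i → sq-mono r (ν≤L i)) ⟩
      a * ∑ {m} (λ _ → sq (suc r) L)
        ≈⟨ *-congˡ (∑-const m _) ⟩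
      a * (ι m * sq (suc r) L) ∎
      where
      P = msq r M

  ⊛-iter : ∀ {n} → Matrix Carrier n → ℕ → Vector Carrier n → Vector Carrier n
  ⊛-iter M zero    v = v
  ⊛-iter M (suc j) v = M ⊛ ⊛-iter M j v

  ∑-⊛ : ∀ {n} {M : Matrix Carrier n} {D} → Symmetric M → RowSum M D → ∀ v → ∑ (M ⊛ v) ≈ D * ∑ v
  ∑-⊛ {M = M} {D} M-sym M-row v = begin-equality
    ∑ (λ i → ∑ (λ j → M i j * v j))   ≈⟨ ∑-comm _ ⟩
    ∑ (λ j → ∑ (λ i → M i j * v j))   ≈⟨ ∑-cong (λ j → trans (sym (∑-*ʳ (v j) _)) (*-congʳ (trans (∑-cong λ i → M-sym i j) (M-row j)))) ⟩
    ∑ (λ j → D * v j)                 ≈⟨ ∑-* D v ⟨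
    D * ∑ v                           ∎

  ∑-iter : ∀ {n} {M : Matrix Carrier n} {D} → Symmetric M → RowSum M D → ∀ j v → ∑ (⊛-iter M j v) ≈ D ^ j * ∑ v
  ∑-iter M-sym M-row zero    v = sym (*-identityˡ _)
  ∑-iter M-sym M-row (suc j) v =
    trans (∑-⊛ M-sym M-row _) (trans (*-congˡ (∑-iter M-sym M-row j v)) (sym (*-assoc _ _ _)))

  -- The form may be negative for odd `j`, so it is controlled through its square: Cauchy-Schwarz
  -- reduces it to the norm of the iterate. Each application of `M` costs a factor Λ in norm and
  -- keeps the entries summing to 0.
  quadratic-form-bound : ∀ {m} {M : Matrix Carrier (suc m)} {D Λ} {μ : Vector Carrier (suc m)} →
    Symmetric M → RowSum M D → Splits M μ → μ zero ≈ D →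
    0# ≤ Λ → (∀ i → μ (suc i) * μ (suc i) ≤ Λ * Λ) →
    ∀ {v} → ∑ v ≈ 0# → ∀ j → - (v ∙ ⊛-iter M j v) ≤ Λ ^ j * v ∙ v
  quadratic-form-bound {m} {M} {D} {Λ} {μ} M-sym M-row M-splits μ₀≈D 0≤Λ μ≤Λ {v} ∑v≈0 j =
    square-mono⁻¹-≤ (0≤* (0≤^ j 0≤Λ) (0≤v∙v v)) (begin
      - (v ∙ w j) * - (v ∙ w j)
        ≈⟨ solve 1 (λ x → :- x :* :- x := x :* x) refl (v ∙ w j) ⟩
      v ∙ w j * v ∙ w j
        ≤⟨ cauchy-schwarz v (w j) ⟩
      v ∙ v * w j ∙ w j
        ≤⟨ *-monoʳ-≤ (0≤v∙v v) (norm j) ⟩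
      v ∙ v * (Λ ^ j * Λ ^ j * v ∙ v)
        ≈⟨ solve 2 (λ a l → a :* (l :* l :* a) := l :* a :* (l :* a)) refl (v ∙ v) (Λ ^ j) ⟩
      Λ ^ j * v ∙ v * (Λ ^ j * v ∙ v) ∎)
    where
    w : ℕ → Vector Carrier (suc m)
    w j = ⊛-iter M j v
    contraction : ∀ {u} → ∑ u ≈ 0# → (M ⊛ u) ∙ (M ⊛ u) ≤ u ∙ u * (Λ * Λ)
    contraction {u} ∑u≈0 = begin
      (M ⊛ u) ∙ (M ⊛ u)    ≈⟨ self-adjoint M-sym u (M ⊛ u) ⟨
      u ∙ (M ⊛ M ⊛ u)      ≈⟨ ∙-cong (λ _ → refl) (⊡-⊛ M M u) ⟨
      -- Used for M² with eigenvalues μ² and `L = Λ * Λ`: the form of M² at `u` is |Mu|², so a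
      -- one-sided bound on it bounds the norm.
      u ∙ ((M ⊡ M) ⊛ u)    ≤⟨ rayleigh (⊡-symmetric M-sym) (⊡-rowSum M-row) (splits-square M-splits)
                                (*-cong μ₀≈D μ₀≈D) (0≤x*x Λ)
                                (λ i → *-mono-≤ (0≤x*x _) (0≤x*x _) (μ≤Λ i) (μ≤Λ i)) ∑u≈0 ⟩
      u ∙ u * (Λ * Λ)      ∎
    norm : ∀ j → w j ∙ w j ≤ Λ ^ j * Λ ^ j * v ∙ v
    norm zero    = ≤-reflexive (sym (trans (*-congʳ (*-identityˡ 1#)) (*-identityˡ _)))
    norm (suc j) = begin
      w (suc j) ∙ w (suc j)
        ≤⟨ contraction (trans (∑-iter M-sym M-row j v) (trans (*-congˡ ∑v≈0) (zeroʳ _))) ⟩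
      w j ∙ w j * (Λ * Λ)
        ≈⟨ *-comm _ _ ⟩
      Λ * Λ * w j ∙ w j
        ≤⟨ *-monoʳ-≤ (0≤x*x Λ) (norm j) ⟩
      Λ * Λ * (Λ ^ j * Λ ^ j * v ∙ v)
        ≈⟨ solve 3 (λ l p a → l :* l :* (p :* p :* a) := l :* p :* (l :* p) :* a) refl Λ (Λ ^ j) (v ∙ v) ⟩
      Λ ^ suc j * Λ ^ suc j * v ∙ v ∎

-- Walks and independent sets

private module ℕΣ = RawSemiringDefs ℕ.+-*-rawSemiring

≤-maximum : ∀ {n} (f : Vector ℕ n) i → f i ℕ.≤ foldr ℕ._⊔_ 0 f
≤-maximum f zero    = ℕₚ.m≤m⊔n _ _
≤-maximum f (suc i) = ℕₚ.≤-trans (≤-maximum (f ∘ suc) i) (ℕₚ.m≤n⊔m _ _)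

sum-≡0 : ∀ {n} {f : Vector ℕ n} → (∀ i → f i ≡ 0) → ℕΣ.sum f ≡ 0
sum-≡0 {zero}  f≡0 = ≡.refl
sum-≡0 {suc n} f≡0 = ≡.cong₂ ℕ._+_ (f≡0 zero) (sum-≡0 (f≡0 ∘ suc))

indicator : Bool → ℕ
indicator b = if b then 1 else 0

module _ {n} (G : Graph n) where
  open Graph G

  adjacency-sym : ∀ i j → adjacency G i j ≡ adjacency G j i
  adjacency-sym i j with i ~? j | j ~? i
  ... | yes _   | yes _   = ≡.refl
  ... | no _    | no _    = ≡.refl
  ... | yes i~j | no ¬j~i = contradiction (~-sym i~j) ¬j~i
  ... | no ¬i~j | yes j~i = contradiction (~-sym j~i) ¬i~j

  -- A nonzero summand of the product would supply an edge `i ~ p` and a walk from `p` of length one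
  -- less, which combine to a walk.
  matrixPower-no-walk : ∀ j {i l} → ¬ Walk G j i l → matrixPower (adjacency G) j i l ≡ 0
  matrixPower-no-walk zero {i} {l} no-walk with i ≟ l
  ... | yes ≡.refl = contradiction [] no-walk
  ... | no  _      = ≡.refl
  matrixPower-no-walk (suc j) {i} {l} no-walk = sum-≡0 term
    where
    term : ∀ p → adjacency G i p ℕ.* matrixPower (adjacency G) j p l ≡ 0
    term p with i ~? p
    ... | yes i~p = ≡.cong (ℕ._+ 0) (matrixPower-no-walk j λ w → no-walk (i~p ∷ w))
    ... | no  _   = ≡.refl

  -- A shortest walk of length at most k would realise the distance.
  no-short-walk : ∀ {k S} → IsKIndependent G k S → ∀ {i l} → i ∈ S → l ∈ S → i ≢ l →
                  ∀ j → j ℕ.≤ k → ¬ Walk G j i l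
  no-short-walk {k} S-indep {i} {l} i∈S l∈S i≢l = <-rec (λ j → j ℕ.≤ k → ¬ Walk G j i l)
    λ j shorter j≤k w → ℕₚ.<⇒≱ (S-indep i∈S l∈S i≢l j (w , λ m w′ → ℕₚ.≮⇒≥ λ m<j →
      shorter m<j (ℕₚ.≤-trans (ℕₚ.<⇒≤ m<j) j≤k) w′)) j≤k

  matrixPower-independent : ∀ {k S} → IsKIndependent G k S → ∀ {i l} → i ∈ S → l ∈ S → i ≢ l →
    ∀ j → j ℕ.≤ k → matrixPower (adjacency G) j i l ≡ 0
  matrixPower-independent S-indep i∈S l∈S i≢l j j≤k =
    matrixPower-no-walk j (no-short-walk S-indep i∈S l∈S i≢l j j≤k)

-- From the norm bound to the ratio bound

module RatioBound {c ℓ₁ ℓ₂} (ℝ : RealNumbers c ℓ₁ ℓ₂) where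
  open RealNumbers ℝ
  open CommutativeRing commutativeRing using (ring)
  open RingProperties ring
  open IntegerCoefficients commutativeRing
  open Determinants ℝ
  open Order ℝ
  open Polynomials ℝ
  open Rayleigh ℝ
  open ≤-Reasoning

  opaque
    unfolding ∑

    ι-sum : ∀ {n} (f : Vector ℕ n) → ι (ℕΣ.sum f) ≈ ∑ (ι ∘ f)
    ι-sum {zero}  f = refl
    ι-sum {suc n} f = trans (ι-+ (f zero) (ℕΣ.sum (f ∘ suc))) (+-congˡ (ι-sum (f ∘ suc)))

  ι-indicator : ∀ b → ι (indicator b) ≈ (if b then 1# else 0#)
  ι-indicator true  = +-identityʳ 1#
  ι-indicator false = refl

  ∑-indicator : ∀ {n} (f : Fin n → Bool) → ∑ (ι ∘ indicator ∘ f) ≈ ι ∣ Vec.tabulate f ∣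
  ∑-indicator {zero}  f = ∑-empty _
  ∑-indicator {suc n} f with f zero | ∑-suc (ι ∘ indicator ∘ f)
  ... | true  | eq = trans eq (+-cong (+-identityʳ 1#) (∑-indicator (f ∘ suc)))
  ... | false | eq = trans eq (trans (+-identityˡ _) (∑-indicator (f ∘ suc)))

  characteristic : ∀ {n} → Subset n → Vector Carrier n
  characteristic S i = ι (indicator (Vec.lookup S i))

  ∑-characteristic : ∀ {n} (S : Subset n) → ∑ (characteristic S) ≈ ι ∣ S ∣
  ∑-characteristic S = trans (∑-indicator (Vec.lookup S))
    (reflexive (≡.cong (λ T → ι ∣ T ∣) (Vecₚ.tabulate∘lookup S)))

  characteristic-∙ : ∀ {n} (S : Subset n) → characteristic S ∙ characteristic S ≈ ι ∣ S ∣
  characteristic-∙ S = trans (∑-cong λ i → idem (Vec.lookup S i)) (∑-characteristic S)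
    where
    idem : ∀ b → ι (indicator b) * ι (indicator b) ≈ ι (indicator b)
    idem true  = trans (*-congʳ (+-identityʳ 1#)) (*-identityˡ _)
    idem false = zeroˡ _

  -- The constants form an eigenvector for `D`, so the summand `b` merely picks up `D ^ j`.
  ⊛-iter-affine : ∀ {n} {M : Matrix Carrier n} {D} → RowSum M D → ∀ a b u j →
    ⊛-iter M j (λ i → a * u i + b) ≋ λ i → a * ⊛-iter M j u i + b * D ^ j
  ⊛-iter-affine M-row a b u zero    i = +-congˡ (sym (*-identityʳ b))
  ⊛-iter-affine {M = M} {D} M-row a b u (suc j) i = begin-equality
    ∑ (λ l → M i l * ⊛-iter M j (λ i → a * u i + b) l)
      ≈⟨ ∑-cong (λ l → trans (*-congˡ (⊛-iter-affine M-row a b u j l))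
           (solve 5 (λ m a w b p → m :* (a :* w :+ b :* p) := a :* (m :* w) :+ b :* p :* m) refl (M i l) a (⊛-iter M j u l) b (D ^ j))) ⟩
    ∑ (λ l → a * (M i l * ⊛-iter M j u l) + b * D ^ j * M i l)
      ≈⟨ trans (∑-+ _ _) (+-cong (sym (∑-* a _)) (sym (∑-* (b * D ^ j) _))) ⟩
    a * ⊛-iter M (suc j) u i + b * D ^ j * ∑ (M i)
      ≈⟨ +-congˡ (trans (*-congˡ (M-row i)) (solve 3 (λ b p d → b :* p :* d := b :* (d :* p)) refl b (D ^ j) D)) ⟩
    a * ⊛-iter M (suc j) u i + b * D ^ suc j ∎

  module _ {n} (G : Graph n) where

    A : Matrix Carrier n
    A i j = ι (adjacency G i j)

    A-symmetric : Symmetric A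
    A-symmetric i j = reflexive (≡.cong ι (adjacency-sym G i j))

    A-rowSum : ∀ {d} → IsRegular G d → RowSum A (ι d)
    A-rowSum regular i = trans (∑-indicator (λ j → does (Graph._~?_ G i j))) (reflexive (≡.cong ι (regular i)))

    walks : ℕ → Matrix Carrier n
    walks j i l = ι (matrixPower (adjacency G) j i l)

    iter-walks : ∀ j v → ⊛-iter A j v ≋ walks j ⊛ v
    iter-walks zero v i = sym (trans (∑-cong λ l → *-congʳ (ι-indicator (does (i ≟ l)))) (δ-sum i v))
    iter-walks (suc j) v i = begin-equality
      A i ∙ ⊛-iter A j v       ≈⟨ ∙-cong (λ _ → refl) (iter-walks j v) ⟩
      A i ∙ (walks j ⊛ v)      ≈⟨ ⊡-⊛ A (walks j) v i ⟨
      (A ⊡ walks j) i ∙ v      ≈⟨ ∙-cong (λ l → trans (∑-cong λ p → sym (ι-* (adjacency G i p) (matrixPower (adjacency G) j p l)))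
                                    (sym (ι-sum (λ p → adjacency G i p ℕ.* matrixPower (adjacency G) j p l)))) (λ _ → refl) ⟩
      walks (suc j) i ∙ v      ∎

    -- For `i` in `S`, entries towards the other vertices of `S` vanish by independence and the
    -- remaining vertices are masked by the indicator, so only the diagonal is left. For `i` outside
    -- `S` both sides carry the factor 0.
    walks-within : ∀ {k S} → IsKIndependent G k S → ∀ j → j ℕ.≤ k → ∀ i →
      characteristic S i * ⊛-iter A j (characteristic S) i ≈ characteristic S i * walks j i i
    walks-within {k} {S} S-indep j j≤k i with Vec.lookup S i in S[i]
    ... | false = trans (zeroˡ _) (sym (zeroˡ _))
    ... | true  = *-congˡ (trans (iter-walks j (characteristic S) i)
                    (trans (∑-cong diagonal) (δ-sum i (walks j i))))
      where
      diagonal : ∀ l → walks j i l * characteristic S l ≈ δ i l * walks j i l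
      diagonal l with i ≟ l
      ... | yes ≡.refl rewrite S[i] = trans (*-congˡ (+-identityʳ 1#)) (*-comm _ _)
      ... | no i≢l with Vec.lookup S l in S[l]
      ...   | false = trans (zeroʳ _) (sym (zeroˡ _))
      ...   | true  = trans (*-congʳ (reflexive (≡.cong ι (matrixPower-independent G S-indep
                        (Vecₚ.lookup⇒[]= i S S[i]) (Vecₚ.lookup⇒[]= l S S[l]) i≢l j j≤k))))
                        (trans (zeroˡ _) (sym (zeroˡ _)))

    -- Exchanging the sums groups the closed walks by their starting vertex, and each vertex of `S`
    -- accounts for at most `W̃ G k` of them.
    closed-walks : ∀ {k S} → IsKIndependent G k S →
      ∑ {k} (λ j → characteristic S ∙ ⊛-iter A (suc (toℕ j)) (characteristic S)) ≤ ι ∣ S ∣ * ι (W̃ G k)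
    closed-walks {k} {S} S-indep = begin
      ∑ (λ j → ∑ (λ i → s i * ⊛-iter A (suc (toℕ j)) s i))
        ≈⟨ ∑-cong {k} (λ j → ∑-cong λ i → walks-within S-indep (suc (toℕ j)) (Finₚ.toℕ<n j) i) ⟩
      ∑ {k} (λ j → ∑ (λ i → s i * walks (suc (toℕ j)) i i))
        ≈⟨ ∑-comm _ ⟩
      ∑ (λ i → ∑ {k} (λ j → s i * walks (suc (toℕ j)) i i))
        ≈⟨ ∑-cong (λ i → ∑-* (s i) _) ⟨
      ∑ (λ i → s i * ∑ {k} (λ j → walks (suc (toℕ j)) i i))
        ≤⟨ ∑-mono-≤ (λ i → *-monoʳ-≤ (0≤ι (indicator (Vec.lookup S i))) (at-most i)) ⟩
      ∑ (λ i → s i * ι (W̃ G k))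
        ≈⟨ ∑-*ʳ (ι (W̃ G k)) s ⟨
      ∑ s * ι (W̃ G k)
        ≈⟨ *-congʳ (∑-characteristic S) ⟩
      ι ∣ S ∣ * ι (W̃ G k) ∎
      where
      s = characteristic S
      closed : Fin n → Vector ℕ k
      closed i j = matrixPower (adjacency G) (suc (toℕ j)) i i
      at-most : ∀ i → ∑ {k} (λ j → walks (suc (toℕ j)) i i) ≤ ι (W̃ G k)
      at-most i = begin
        ∑ (ι ∘ closed i)        ≈⟨ ι-sum (closed i) ⟨
        ι (ℕΣ.sum (closed i))   ≤⟨ ι-mono-≤ (≤-maximum (λ i → ℕΣ.sum (closed i)) i) ⟩
        ι (W̃ G k)               ∎

  powerSum≈∑ : ∀ x k → powerSum x k ≈ ∑ {k} (λ j → x ^ suc (toℕ j))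
  powerSum≈∑ x k = reflexive (≡.sym (∑≡sum {k} (λ j → x ^ suc (toℕ j))))

  0≤powerSum : ∀ {x} k → 0# ≤ x → 0# ≤ powerSum x k
  0≤powerSum {x} k 0≤x = begin
    0#                                  ≤⟨ 0≤∑ (λ j → 0≤^ (suc (toℕ j)) 0≤x) ⟩
    ∑ {k} (λ j → x ^ suc (toℕ j))       ≈⟨ powerSum≈∑ x k ⟨
    powerSum x k                        ∎

  0<powerSum : ∀ {x} k → 0# < x → 0# < powerSum x (suc k)
  0<powerSum {x} k 0<x = begin-strict
    0#                                          <⟨ 0<x ⟩
    x                                           ≈⟨ solve 1 (λ x → x := x :* con (+ 1) :+ con (+ 0)) refl x ⟩
    x * 1# + 0#                                 ≤⟨ +-mono-≤ (≤-reflexive refl) (0≤∑ (λ j → 0≤^ (suc (suc (toℕ j))) (<⇒≤ 0<x))) ⟩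
    x * 1# + ∑ {k} (λ j → x ^ suc (suc (toℕ j)))  ≈⟨ ∑-suc {k} (λ j → x ^ suc (toℕ j)) ⟨
    ∑ {suc k} (λ j → x ^ suc (toℕ j))           ≈⟨ powerSum≈∑ x (suc k) ⟨
    powerSum x (suc k)                          ∎

  x≤x⊔y : ∀ x y → x ≤ x ⊔ y
  x≤x⊔y x y = proj₁ (supremum x y)

  y≤x⊔y : ∀ x y → y ≤ x ⊔ y
  y≤x⊔y x y = proj₁ (proj₂ (supremum x y))

  square-≤ : ∀ {x y} → x ≤ y → - y ≤ x → x * x ≤ y * y
  square-≤ {x} {y} x≤y -y≤x = 0≤y-x⇒x≤y (begin
    0#                       ≤⟨ 0≤* (x≤y⇒0≤y-x x≤y) (x≤y⇒0≤y-x -y≤x) ⟩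
    (y - x) * (x - - y)      ≈⟨ solve 2 (λ x y → (y :- x) :* (x :- :- y) := y :* y :- x :* x) refl x y ⟩
    y * y - x * x            ∎)

  module _ {m} {G : Graph (2 ℕ.+ m)} {d Λ} (ndΛ : IsNDΛGraph ℝ G d Λ) where
    open IsNDΛGraph ndΛ

    private
      λ₂≤Λ : λ₂ ≤ Λ
      λ₂≤Λ = ≤-trans (x≤x⊔y λ₂ (- λ₂)) (≤-trans (x≤x⊔y (abs λ₂) (abs λₙ)) (≤-reflexive (sym Λ≈max)))

      -λ₂≤Λ : - λ₂ ≤ Λ
      -λ₂≤Λ = ≤-trans (y≤x⊔y λ₂ (- λ₂)) (≤-trans (x≤x⊔y (abs λ₂) (abs λₙ)) (≤-reflexive (sym Λ≈max)))

      -Λ≤λₙ : - Λ ≤ λₙ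
      -Λ≤λₙ = ≤-trans (neg-mono-≤ (≤-trans (y≤x⊔y λₙ (- λₙ)) (≤-trans (y≤x⊔y (abs λ₂) (abs λₙ)) (≤-reflexive (sym Λ≈max)))))
        (≤-reflexive (-‿involutive λₙ))

    -- Λ bounds both `λ₂` and `- λ₂`, whose sum is 0; the sign of `λ₂` need not be known.
    0≤Λ : 0# ≤ Λ
    0≤Λ = *-cancelˡ-≤ (0<ι 1) (begin
      ι 2 * 0#    ≈⟨ zeroʳ _ ⟩
      0#          ≈⟨ -‿inverseʳ λ₂ ⟨
      λ₂ - λ₂     ≤⟨ +-mono-≤ λ₂≤Λ -λ₂≤Λ ⟩
      Λ + Λ       ≈⟨ solve 1 (λ x → x :+ x := (con (+ 1) :+ (con (+ 1) :+ con (+ 0))) :* x) refl Λ ⟩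
      ι 2 * Λ     ∎)

    -- By monotonicity every eigenvalue after the first lies between `λₙ` and `λ₂`, hence between -Λ
    -- and Λ.
    eigenvalue-≤Λ : ∀ i → eigenvalue (suc i) * eigenvalue (suc i) ≤ Λ * Λ
    eigenvalue-≤Λ i = square-≤
      (≤-trans (IsSpectrum.decreasing isSpectrum {suc zero} {suc i} (ℕ.s≤s ℕ.z≤n)) λ₂≤Λ)
      (≤-trans -Λ≤λₙ (IsSpectrum.decreasing isSpectrum (Finₚ.≤fromℕ (suc i))))

    module _ {k} {S : Subset (2 ℕ.+ m)} (S-indep : IsKIndependent G k S) where
      private
        n′ = ι (2 ℕ.+ m)
        a = ι ∣ S ∣
        D = ι d
        s = characteristic S
        w : ℕ → Vector Carrier (2 ℕ.+ m)
        w j = ⊛-iter (A G) j s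
        -- n times the projection of the indicator of S to the space 1^⊥
        v : Vector Carrier (2 ℕ.+ m)
        v i = n′ * s i + - a
        row : RowSum (A G) D
        row = A-rowSum G regular

        ∑v≈0 : ∑ v ≈ 0#
        ∑v≈0 = begin-equality
          ∑ v                    ≈⟨ trans (∑-+ _ _) (+-cong (sym (∑-* n′ s)) (∑-const (2 ℕ.+ m) (- a))) ⟩
          n′ * ∑ s + n′ * - a    ≈⟨ +-congʳ (*-congˡ (∑-characteristic S)) ⟩
          n′ * a + n′ * - a      ≈⟨ solve 2 (λ n a → n :* a :+ n :* :- a := con (+ 0)) refl n′ a ⟩
          0#                     ∎

        -- One factor `n′` stays outside: `v ∙ v`, the case `j = 0`, carries the same one, and
        -- `bound` cancels them.
        quadratic-form : ∀ j → v ∙ ⊛-iter (A G) j v ≈ n′ * (n′ * s ∙ w j - a * a * D ^ j)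
        quadratic-form j = begin-equality
          v ∙ ⊛-iter (A G) j v
            ≈⟨ ∑-cong (λ i → trans (*-congˡ (⊛-iter-affine row n′ (- a) s j i))
                 (solve 4 (λ v n w c → v :* (n :* w :+ c) := n :* (v :* w) :+ c :* v) refl (v i) n′ (w j i) (- a * D ^ j))) ⟩
          ∑ (λ i → n′ * (v i * w j i) + - a * D ^ j * v i)
            -- The constant part of the iterate is orthogonal to `v`.
            ≈⟨ trans (∑-+ _ _) (+-cong (sym (∑-* n′ _)) (trans (sym (∑-* _ v)) (trans (*-congˡ ∑v≈0) (zeroʳ _)))) ⟩
          n′ * v ∙ w j + 0#
            ≈⟨ +-identityʳ _ ⟩
          n′ * v ∙ w j
            ≈⟨ *-congˡ (trans (∑-cong λ i → trans (distribʳ _ _ _) (+-congʳ (*-assoc _ _ _)))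
                 (trans (∑-+ _ _) (+-cong (sym (∑-* n′ _)) (sym (∑-* (- a) (w j)))))) ⟩
          n′ * (n′ * s ∙ w j + - a * ∑ (w j))
            ≈⟨ *-congˡ (+-congˡ (*-congˡ (trans (∑-iter (A-symmetric G) row j s) (*-congˡ (∑-characteristic S))))) ⟩
          n′ * (n′ * s ∙ w j + - a * (D ^ j * a))
            ≈⟨ *-congˡ (+-congˡ (solve 2 (λ a p → :- a :* (p :* a) := :- (a :* a :* p)) refl a (D ^ j))) ⟩
          n′ * (n′ * s ∙ w j - a * a * D ^ j) ∎

        v∙v : v ∙ v ≈ n′ * (n′ * a - a * a)
        v∙v = trans (quadratic-form 0) (*-congˡ (+-cong (*-congˡ (characteristic-∙ S)) (-‿cong (*-identityʳ _))))

        bound : ∀ j → a * a * D ^ j ≤ n′ * s ∙ w j + Λ ^ j * (n′ * a - a * a)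
        bound j = 0≤y-x⇒x≤y (begin
          0#
            ≤⟨ x≤y⇒0≤y-x (*-cancelˡ-≤ (0<ι (suc m)) (begin
              n′ * - (n′ * s ∙ w j - a * a * D ^ j)
                ≈⟨ -‿distribʳ-* _ _ ⟨
              - (n′ * (n′ * s ∙ w j - a * a * D ^ j))
                ≈⟨ -‿cong (quadratic-form j) ⟨
              - (v ∙ ⊛-iter (A G) j v)
                ≤⟨ quadratic-form-bound (A-symmetric G) row (spectrum⇒splits isSpectrum) λ₁≈d 0≤Λ eigenvalue-≤Λ ∑v≈0 j ⟩
              Λ ^ j * v ∙ v
                ≈⟨ *-congˡ v∙v ⟩
              Λ ^ j * (n′ * (n′ * a - a * a))
                ≈⟨ solve 3 (λ l n x → l :* (n :* x) := n :* (l :* x)) refl (Λ ^ j) n′ (n′ * a - a * a) ⟩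
              n′ * (Λ ^ j * (n′ * a - a * a)) ∎)) ⟩
          Λ ^ j * (n′ * a - a * a) - - (n′ * s ∙ w j - a * a * D ^ j)
            ≈⟨ solve 3 (λ l q p → l :- :- (q :- p) := q :+ l :- p) refl (Λ ^ j * (n′ * a - a * a)) (n′ * s ∙ w j) (a * a * D ^ j) ⟩
          n′ * s ∙ w j + Λ ^ j * (n′ * a - a * a) - a * a * D ^ j ∎)

        summed-bound : a * a * powerSum D k ≤ n′ * (a * ι (W̃ G k)) + powerSum Λ k * (n′ * a - a * a)
        summed-bound = begin
          a * a * powerSum D k
            ≈⟨ *-congˡ (powerSum≈∑ D k) ⟩
          a * a * ∑ {k} (λ j → D ^ suc (toℕ j))
            ≈⟨ ∑-* _ _ ⟩
          ∑ {k} (λ j → a * a * D ^ suc (toℕ j))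
            ≤⟨ ∑-mono-≤ {k} (λ j → bound (suc (toℕ j))) ⟩
          ∑ {k} (λ j → n′ * s ∙ w (suc (toℕ j)) + Λ ^ suc (toℕ j) * (n′ * a - a * a))
            ≈⟨ trans (∑-+ _ _) (+-cong (sym (∑-* n′ _)) (sym (∑-*ʳ _ _))) ⟩
          n′ * ∑ {k} (λ j → s ∙ w (suc (toℕ j))) + ∑ {k} (λ j → Λ ^ suc (toℕ j)) * (n′ * a - a * a)
            ≤⟨ +-mono-≤ (*-monoʳ-≤ (0≤ι (2 ℕ.+ m)) (closed-walks G S-indep)) (≤-reflexive (*-congʳ (sym (powerSum≈∑ Λ k)))) ⟩
          n′ * (a * ι (W̃ G k)) + powerSum Λ k * (n′ * a - a * a) ∎

      ratio-bound : (powerSum D k + powerSum Λ k) * a ≤ n′ * (ι (W̃ G k) + powerSum Λ k)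
      -- `summed-bound` carries a factor `a` throughout. For `a ≈ 0#` it cannot be cancelled, but
      -- then the left side is 0 and the right side nonnegative.
      ratio-bound = 0≤-cases (0≤ι ∣ S ∣)
        (λ a≈0 → ≤-trans (≤-reflexive (trans (*-congˡ a≈0) (zeroʳ _)))
          (0≤* (0≤ι (2 ℕ.+ m)) (0≤+ (0≤ι (W̃ G k)) (0≤powerSum k 0≤Λ))))
        λ 0<a → *-cancelˡ-≤ 0<a (0≤y-x⇒x≤y (begin
          0#
            ≤⟨ x≤y⇒0≤y-x summed-bound ⟩
          n′ * (a * ι (W̃ G k)) + powerSum Λ k * (n′ * a - a * a) - a * a * powerSum D k
            ≈⟨ solve 5 (λ n a W pΛ pD → n :* (a :* W) :+ pΛ :* (n :* a :- a :* a) :- a :* a :* pD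
                 := a :* (n :* (W :+ pΛ)) :- a :* ((pD :+ pΛ) :* a)) refl n′ a (ι (W̃ G k)) (powerSum Λ k) (powerSum D k) ⟩
          a * (n′ * (ι (W̃ G k) + powerSum Λ k)) - a * ((powerSum D k + powerSum Λ k) * a) ∎))

theorem4p2 : ∀ {c ℓ₁ ℓ₂} (ℝ : RealNumbers c ℓ₁ ℓ₂) → let open RealNumbers ℝ in
    ∀ {m} → let n = 2 ℕ.+ m in
    (G : Graph n) (d : ℕ) (Λ : Carrier) → IsNDΛGraph ℝ G d Λ →
    1 ℕ.≤ d →
    (k : ℕ) → 1 ℕ.≤ k →
    (α : ℕ) → IsKIndependenceNumber G k α →
    Σ[ D#0 ∈ (powerSum (ι d) k + powerSum Λ k) # 0# ]
    (ι α ≤ ι n * ((ι (W̃ G k) + powerSum Λ k) / (powerSum (ι d) k + powerSum Λ k) ⟨ D#0 ⟩))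
theorem4p2 ℝ {m} G (suc d) Λ ndΛ 1≤d (suc k) 1≤k _ ((S , S-indep , ≡.refl) , _) =
  #-sym (<⇒# 0<Den) , *-cancelˡ-≤ 0<Den (begin
    Den * ι ∣ S ∣                             ≤⟨ ratio-bound ndΛ S-indep ⟩
    n′ * Num                                  ≈⟨ *-congˡ (/-*-cancel Num _) ⟨
    n′ * (Num / Den ⟨ _ ⟩ * Den)              ≈⟨ trans (sym (*-assoc _ _ _)) (*-comm _ _) ⟩
    Den * (n′ * (Num / Den ⟨ _ ⟩))            ∎)
  where
  open RealNumbers ℝ
  open Order ℝ
  open ≤-Reasoning
  open RatioBound ℝ
  n′ = ι (2 ℕ.+ m)
  Num = ι (W̃ G (suc k)) + powerSum Λ (suc k)
  Den = powerSum (ι (suc d)) (suc k) + powerSum Λ (suc k)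
  -- With `d` and `k` positive the first summand `d` already makes the denominator positive; for
  -- `d = 0` or `k = 0` it would be 0.
  0<Den : 0# < Den
  0<Den = begin-strict
    0#                                     <⟨ 0<powerSum k (0<ι d) ⟩
    powerSum (ι (suc d)) (suc k)           ≈⟨ +-identityʳ _ ⟨
    powerSum (ι (suc d)) (suc k) + 0#      ≤⟨ +-mono-≤ (≤-reflexive refl) (0≤powerSum (suc k) (0≤Λ ndΛ)) ⟩
    Den                                    ∎
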